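{- Let $G$ be a finite simple triangle-free graph with maximum degree $\Delta(G)\leq 4$. Then $$\frac{7}{4}\alpha(G)+\beta(G)\geq n(G),$$ with equality if and only if every connected component $C$ of $G$ satisfies $n(C)=13$, $\alpha(C)=4$, and $\beta(C)=6$.
   Context: All graphs are simple, finite and undirected. $n(G)$ is the number of vertices of $G$, $\alpha(G)$ is the independence number (maximum size of a set of pairwise non-adjacent vertices), and $\beta(G)$ is the matching number (maximum number of pairwise disjoint edges). Triangle-free means $G$ contains no $K_3$ as a subgraph. -}

module Defs where

open import Data.Fin.Base using (Fin; _<_)
open import Data.Fin.Properties using (_≟_; _<?_; all?)
open import Data.Fin.Subset using (Subset; _∈_; ∣_∣; inside; outside)
open import Data.Fin.Subset.Properties using (_∈?_)
open import Data.Integer.Base using (+_)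
open import Data.List.Base
  using (List; []; _∷_; [_]; _++_; map; filter; length; lookup; allFin; cartesianProduct)
open import Data.List.Extrema.Nat using (max)
open import Data.Nat.Base using (ℕ; zero; suc)
open import Data.Product.Base using (_×_; _,_; ∃-syntax)
open import Data.Rational.Base using (ℚ; _/_)
open import Data.Vec.Base using ([]; _∷_)
open import Function.Bundles using (_⇔_)
open import Level using (0ℓ)
open import Relation.Binary.Construct.Closure.ReflexiveTransitive using (Star)
open import Relation.Binary.Core using (Rel)
open import Relation.Binary.Definitions using (Decidable; Symmetric)
open import Relation.Binary.PropositionalEquality using (_≡_; _≢_)
open import Relation.Nullary.Decidable using (¬?; _×-dec_; _→-dec_)
open import Relation.Nullary.Negation using (¬_)
import Relation.Unary as U

subsets : ∀ m → List (Subset m)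
subsets zero    = [ [] ]
subsets (suc m) = map (inside ∷_) (subsets m) ++ map (outside ∷_) (subsets m)

-- The value is 0 when no subset satisfies P; this does not happen below,
-- since the empty set is both independent and a matching.
maxSize : ∀ {m} {P : U.Pred (Subset m) 0ℓ} → U.Decidable P → ℕ
maxSize {m} P? = max 0 (map ∣_∣ (filter P? (subsets m)))

record Graph : Set₁ where
  infix 4 _~_ _~?_
  field
    n      : ℕ
    _~_    : Rel (Fin n) 0ℓ
    _~?_   : Decidable _~_
    ~-sym  : Symmetric _~_
    ~-irr  : ∀ {v} → ¬ (v ~ v)

  Vertex : Set
  Vertex = Fin n

  TriangleFree : Set
  TriangleFree = ∀ u v w → ¬ (u ~ v × v ~ w × u ~ w)

  degree : Vertex → ℕ
  degree v = length (filter (v ~?_) (allFin n))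

  Δ : ℕ
  Δ = max 0 (map degree (allFin n))

  Independent : Subset n → Set
  Independent S = ∀ u v → u ∈ S → v ∈ S → ¬ (u ~ v)

  independent? : U.Decidable Independent
  independent? S = all? λ u → all? λ v →
    (u ∈? S) →-dec ((v ∈? S) →-dec ¬? (u ~? v))

  α : ℕ
  α = maxSize independent?

  -- Each edge is listed exactly once, with its smaller endpoint first.
  edges : List (Vertex × Vertex)
  edges = filter (λ (u , v) → (u <? v) ×-dec (u ~? v))
                 (cartesianProduct (allFin n) (allFin n))

  Edge : Set
  Edge = Fin (length edges)

  Disjoint : Rel (Vertex × Vertex) 0ℓ
  Disjoint (u , v) (x , y) = u ≢ x × u ≢ y × v ≢ x × v ≢ y

  disjoint? : Decidable Disjoint
  disjoint? (u , v) (x , y) =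
    ¬? (u ≟ x) ×-dec ¬? (u ≟ y) ×-dec ¬? (v ≟ x) ×-dec ¬? (v ≟ y)

  Matching : Subset (length edges) → Set
  Matching M = ∀ (e f : Edge) → e ∈ M → f ∈ M → e ≢ f →
               Disjoint (lookup edges e) (lookup edges f)

  matching? : U.Decidable Matching
  matching? M = all? λ e → all? λ f →
    (e ∈? M) →-dec ((f ∈? M) →-dec (¬? (e ≟ f) →-dec
    disjoint? (lookup edges e) (lookup edges f)))

  β : ℕ
  β = maxSize matching?

  -- Star _~_ u v: there is a walk from u to v.
  IsComponent : Subset n → Set
  IsComponent C = ∃[ v ] (∀ u → u ∈ C ⇔ Star _~_ v u)

open Graph public
  using (n; TriangleFree; Δ; α; β; IsComponent)

-- The induced subgraph: vertex i is the i-th element of S in increasing order.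
infix 8 _[[_]]
_[[_]] : (G : Graph) → Subset (n G) → Graph
G [[ S ]] = record
  { n     = length vs
  ; _~_   = λ i j → lookup vs i G.~ lookup vs j
  ; _~?_  = λ i j → lookup vs i G.~? lookup vs j
  ; ~-sym = G.~-sym
  ; ~-irr = G.~-irr
  }
  where
  module G = Graph G
  vs = filter (_∈? S) (allFin G.n)

ℕ→ℚ : ℕ → ℚ
ℕ→ℚ k = + k / 1

{-# OPTIONS --safe #-}
-- Write the inequality as 4 n ≤ 7 α + 4 β. Removing a vertex that every maximum
-- matching covers lowers β by one and does not raise α, so one may assume that there
-- is no such vertex; then, by Gallai's lemma, a maximum matching of a connected graph
-- misses at most one vertex. In that case it suffices that 7 α ≥ 2 (n + 1), which
-- follows from Shearer's bound α ≥ Σ f(d(v)) with f(4) = 127/425 > 2/7 by rounding up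
-- (for n = 3 with f(2) = 2/5), with equality only for n = 13 and α = 4. Such a
-- component is 4-regular since R(3,4) = 9, hence no deleted vertex can have been
-- adjacent to it, and equality persists only if nothing was deleted.
module Submission where

-- Deleting a vertex can disconnect the graph, and strictness has to survive the deletion. The
-- induction therefore runs over all vertex subsets of the fixed graph `G` and carries two
-- statements: the inequality for every subset and, for connected ones, the alternative of surplus
-- at least 1 or 13 vertices with α ≤ 4. A deleted vertex takes 4 off the left side and at least one
-- matching edge, again 4, off the right, so surplus survives, and one strict component of the
-- remainder makes the whole strict. The component holding the partner of the deleted vertex is such
-- a one: in a tight component the partner would have a fifth neighbour.
--
-- A matching that misses one vertex leaves 7 α ≥ 2 n + 2 to show. Shearer's constant exceeds 2/7 so
-- little (7 · 127/425 - 2 = 39/425) that this follows without rounding only from n = 22 on; below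
-- that, integrality of α decides order by order.
--
-- Matchings are involutions on vertices, so exchanging an edge changes few values, and exhaustive
-- search over functions makes "every maximum matching covers v" decidable.

module Development where

  open import Defs
  import Algebra.Properties.Semiring.Sum as SemiringSum
  open import Data.Bool.Base using (Bool; true; false; _∧_; _∨_; not; if_then_else_)
  import Data.Bool.Properties as Bool
  open import Data.Empty using (⊥)
  open import Data.Fin.Base as Fin using (Fin; zero; suc)
  open import Data.Fin.Properties as Fin using (_≟_; any?; all?)
  open import Data.Fin.Subset using (Subset; _∈_; ∣_∣)
  open import Data.Fin.Subset.Properties using (_∈?_; anySubset?)
  import Data.Integer.Base as ℤ
  import Data.Integer.Properties as ℤ
  open import Data.List.Base as List using (List; length; filter; allFin; cartesianProduct)
  open import Data.List.Extrema.Nat using (xs≤max; argmax-sel)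
  import Data.List.Membership.Propositional as List
  import Data.List.Membership.Propositional.Properties as List
  open import Data.List.Relation.Unary.All as All using ()
  open import Data.List.Relation.Unary.AllPairs using (_∷_)
  import Data.List.Relation.Unary.Any as Any
  open import Data.List.Relation.Unary.Unique.Propositional using (Unique)
  import Data.List.Relation.Unary.Unique.Propositional.Properties as Unique
  open import Data.Nat.Base using (ℕ; zero; suc; _+_; _*_; _≤_; _<_; z≤n; s≤s; s≤s⁻¹)
  open import Data.Nat.Properties as ℕ hiding (_≟_)
  open import Data.Nat.Tactic.RingSolver using (solve-∀)
  open import Data.Product.Base using (_×_; _,_; ∃; ∃-syntax; proj₁; proj₂)
  import Data.Rational.Base as ℚ
  import Data.Rational.Properties as ℚ
  import Data.Rational.Unnormalised.Base as ℚᵘ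
  import Data.Rational.Unnormalised.Properties as ℚᵘ
  open import Data.Sum.Base using (_⊎_; inj₁; inj₂)
  open import Data.Vec.Base as Vec using (Vec; []; _∷_)
  open import Data.Vec.Properties using (lookup∘tabulate; []=⇒lookup; lookup⇒[]=)
  open import Function.Base using (_∘_)
  open import Function.Bundles using (Equivalence; mk⇔)
  open import Level using (0ℓ)
  open import Relation.Binary.Construct.Closure.ReflexiveTransitive as Star using (Star; ε; _◅_; _◅◅_)
  open import Relation.Binary.Definitions using (tri<; tri≈; tri>)
  open import Relation.Binary.PropositionalEquality
  open import Relation.Nullary.Decidable
    using (Dec; yes; no; does; from-yes; _×-dec_; _⊎-dec_; _→-dec_; dec-true; dec-false; ¬?; map′; decidable-stable)
  open import Relation.Nullary.Negation using (¬_; contradiction)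
  import Relation.Unary as U

  module ∑ = SemiringSum ℕ.+-*-semiring

  -- Sums and cardinalities

  ι : Bool → ℕ
  ι true  = 1
  ι false = 0

  opaque

    sum : ∀ {m} → (Fin m → ℕ) → ℕ
    sum = ∑.sum

    sum-zero : (f : Fin 0 → ℕ) → sum f ≡ 0
    sum-zero f = refl

    sum-suc : ∀ {m} (f : Fin (suc m) → ℕ) → sum f ≡ f zero + sum (λ i → f (suc i))
    sum-suc f = refl

    sum-cong : ∀ {m} {f g : Fin m → ℕ} → (∀ i → f i ≡ g i) → sum f ≡ sum g
    sum-cong = ∑.sum-cong-≗

    sum-+ : ∀ {m} (f g : Fin m → ℕ) → sum (λ i → f i + g i) ≡ sum f + sum g
    sum-+ = ∑.∑-distrib-+

    sum-swap : ∀ {m k} (f : Fin m → Fin k → ℕ) →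
      sum (λ i → sum (λ j → f i j)) ≡ sum (λ j → sum (λ i → f i j))
    sum-swap = ∑.∑-comm

    sum-*ˡ : ∀ {m} c (f : Fin m → ℕ) → sum (λ i → c * f i) ≡ c * sum f
    sum-*ˡ c f = sym (∑.*-distribˡ-sum c f)

    sum-mono : ∀ {m} {f g : Fin m → ℕ} → (∀ i → f i ≤ g i) → sum f ≤ sum g
    sum-mono {zero}  f≤g = z≤n
    sum-mono {suc m} f≤g = +-mono-≤ (f≤g zero) (sum-mono (λ i → f≤g (suc i)))

    sum-const : ∀ m c → sum {m} (λ _ → c) ≡ m * c
    sum-const zero    c = refl
    sum-const (suc m) c = cong (c +_) (sum-const m c)

  sum-≡0 : ∀ {m} {f : Fin m → ℕ} → (∀ i → f i ≡ 0) → sum f ≡ 0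
  sum-≡0 {f = f} f≡0 = trans (sum-cong (λ i → trans (f≡0 i) (sym (*-zeroˡ (f i))))) (sum-*ˡ 0 f)

  δ : ∀ {m} → Fin m → Fin m → ℕ
  δ v i = ι (does (i ≟ v))

  δ-refl : ∀ {m} (v : Fin m) → δ v v ≡ 1
  δ-refl v with v ≟ v
  ... | yes _  = refl
  ... | no v≢v = contradiction refl v≢v

  δ-≢ : ∀ {m} {v i : Fin m} → i ≢ v → δ v i ≡ 0
  δ-≢ {v = v} {i} i≢v with i ≟ v
  ... | yes i≡v = contradiction i≡v i≢v
  ... | no _    = refl

  sum-δ-* : ∀ {m} (v : Fin m) (f : Fin m → ℕ) → sum (λ i → δ v i * f i) ≡ f v
  sum-δ-* zero f = trans (sum-suc _)
    (trans (cong₂ _+_ (*-identityˡ (f zero)) (sum-≡0 λ i → refl)) (+-identityʳ (f zero)))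
  sum-δ-* (suc v) f = trans (sum-suc _) (trans (sum-cong lemma) (sum-δ-* v (λ i → f (suc i))))
    where
    lemma : ∀ i → δ (suc v) (suc i) * f (suc i) ≡ δ v i * f (suc i)
    lemma i with i ≟ v
    ... | yes _ = refl
    ... | no _  = refl

  sum-δ : ∀ {m} (v : Fin m) → sum (δ v) ≡ 1
  sum-δ v = trans (sum-cong (λ i → sym (*-identityʳ (δ v i)))) (sum-δ-* v (λ _ → 1))

  #_ : ∀ {m} → (Fin m → Bool) → ℕ
  # S = sum (λ v → ι (S v))

  member⇒#>0 : ∀ {m} (S : Fin m → Bool) v → S v ≡ true → 1 ≤ # S
  member⇒#>0 S v v∈S = subst (_≤ # S) (sum-δ v) (sum-mono lemma)
    where
    lemma : ∀ i → δ v i ≤ ι (S i)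
    lemma i with i ≟ v
    ... | yes refl rewrite v∈S = ≤-refl
    ... | no _ = z≤n

  -- If `f` exceeded `g` at every member, the two sums would differ by at least `# S`, which is
  -- positive.
  weighted-pigeonhole : ∀ {m} (S : Fin m → Bool) (f g : Fin m → ℕ) → 1 ≤ # S →
    sum (λ v → ι (S v) * f v) ≤ sum (λ v → ι (S v) * g v) →
    ∃[ v ] S v ≡ true × f v ≤ g v
  weighted-pigeonhole {m} S f g S>0 Σf≤Σg
    with any? (λ v → (S v Data.Bool.≟ true) ×-dec (f v ≤? g v))
    where import Data.Bool
  ... | yes found = found
  ... | no none = contradiction (≤-trans Σg<Σf Σf≤Σg) (<⇒≱ (m<n+m _ S>0))
    where
    pointwise : ∀ v → ι (S v) + ι (S v) * g v ≤ ι (S v) * f v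
    pointwise v with S v in eq
    ... | false = z≤n
    ... | true  = subst₂ _≤_ (cong suc (sym (*-identityˡ (g v)))) (sym (*-identityˡ (f v)))
                    (≰⇒> (λ f≤g → none (v , eq , f≤g)))
    Σg<Σf : # S + sum (λ v → ι (S v) * g v) ≤ sum (λ v → ι (S v) * f v)
    Σg<Σf = subst (_≤ sum (λ v → ι (S v) * f v)) (sum-+ _ _) (sum-mono pointwise)

  -- Chebyshev's sum inequality over the edges of a symmetric kernel. Exchanging `u` and `v`
  -- preserves each double sum, so twice each sum can be compared pair by pair; `opposite` says that
  -- `f` and `g` are oppositely ordered wherever `K` is nonzero.
  chebyshev : ∀ {m} (K : Fin m → Fin m → ℕ) (f g : Fin m → ℕ) →
    (∀ u v → K u v ≡ K v u) →
    (∀ u v → K u v * (g u * f u + g v * f v) ≤ K u v * (g u * f v + g v * f u)) →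
    sum (λ u → sum (λ v → K u v * (g u * f u))) ≤ sum (λ u → sum (λ v → K u v * (g u * f v)))
  chebyshev {m} K f g K-sym opposite = *-cancelˡ-≤ 2 (begin
    2 * A                                                           ≡⟨ symmetrise (λ u v → g u * f u) ⟩
    sum (λ u → sum (λ v → K u v * (g u * f u + g v * f v)))         ≤⟨ sum-mono (λ u → sum-mono (opposite u)) ⟩
    sum (λ u → sum (λ v → K u v * (g u * f v + g v * f u)))         ≡⟨ symmetrise (λ u v → g u * f v) ⟨
    2 * B                                                           ∎)
    where
    open ≤-Reasoning
    A = sum (λ u → sum (λ v → K u v * (g u * f u)))
    B = sum (λ u → sum (λ v → K u v * (g u * f v)))
    symmetrise : ∀ (h : Fin m → Fin m → ℕ) →
      2 * sum (λ u → sum (λ v → K u v * h u v)) ≡ sum (λ u → sum (λ v → K u v * (h u v + h v u)))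
    symmetrise h = begin-equality
      2 * T                                                      ≡⟨ cong (T +_) (+-identityʳ T) ⟩
      T + T                                                      ≡⟨ cong (T +_) (sum-swap _) ⟩
      T + sum (λ v → sum (λ u → K u v * h u v))
        ≡⟨ cong (T +_) (sum-cong λ v → sum-cong λ u → cong (_* h u v) (K-sym u v)) ⟩
      T + sum (λ v → sum (λ u → K v u * h u v))                  ≡⟨ sum-+ _ _ ⟨
      sum (λ u → sum (λ v → K u v * h u v) + sum (λ v → K u v * h v u))
        ≡⟨ sum-cong (λ u → sym (sum-+ _ _)) ⟩
      sum (λ u → sum (λ v → K u v * h u v + K u v * h v u))
        ≡⟨ sum-cong (λ u → sum-cong λ v → sym (*-distribˡ-+ (K u v) (h u v) (h v u))) ⟩
      sum (λ u → sum (λ v → K u v * (h u v + h v u)))            ∎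
      where T = sum (λ u → sum (λ v → K u v * h u v))

  -- Opaque, so that products with the numeral 850 are not unfolded.
  opaque

    W : ℕ
    W = 850

    W≡850 : W ≡ 850
    W≡850 = refl

    W*≡850* : ∀ a → W * a ≡ 850 * a
    W*≡850* a = refl

  -- 850 f(d) for Shearer's weights f(0) = 1, f(d) = (1 + (d² − d) f(d − 1)) / (d² + 1);
  -- only d ≤ 4 is meaningful.
  weight : ℕ → ℕ
  weight 0 = 850
  weight 1 = 425
  weight 2 = 340
  weight 3 = 289
  weight _ = 254

  -- weight (d − 1) − weight d for 1 ≤ d ≤ 4; the value at 0 only keeps the sequence antitone.
  decrement : ℕ → ℕ
  decrement 0 = 425
  decrement 1 = 425
  decrement 2 = 85
  decrement 3 = 51
  decrement _ = 35

  -- The decrements do not increase with the degree, so a vertex that loses `c` neighbours gains at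
  -- least `c` times the decrement at its old degree.
  weight-convex : ∀ {d c} → d + c ≤ 4 → weight (d + c) + c * decrement (d + c) ≤ weight d
  weight-convex {d} {c} d+c≤4 = table {d} (s≤s (≤-trans (m≤m+n d c) d+c≤4)) {c} (s≤s (≤-trans (m≤n+m c d) d+c≤4)) d+c≤4
    where
    table : ∀ {d} → d < 5 → ∀ {c} → c < 5 → d + c ≤ 4 → weight (d + c) + c * decrement (d + c) ≤ weight d
    table = from-yes (allUpTo? (λ d → allUpTo? (λ c →
      (d + c ≤? 4) →-dec (weight (d + c) + c * decrement (d + c) ≤? weight d)) 5) 5)

  -- Amounts to (decrement d - decrement e)(d - e) ≤ 0, the ordering that `chebyshev` asks for.
  decrement-opposite : ∀ {d e} → d ≤ 4 → e ≤ 4 → decrement d * d + decrement e * e ≤ decrement d * e + decrement e * d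
  decrement-opposite {d} {e} d≤4 e≤4 = table {d} (s≤s d≤4) {e} (s≤s e≤4)
    where
    table : ∀ {d} → d < 5 → ∀ {e} → e < 5 → decrement d * d + decrement e * e ≤ decrement d * e + decrement e * d
    table = from-yes (allUpTo? (λ d → allUpTo? (λ e →
      decrement d * d + decrement e * e ≤? decrement d * e + decrement e * d) 5) 5)

  -- Shearer's recurrence scaled by 850, with f(d - 1) written as f(d) plus the decrement; equality
  -- holds for every d ≤ 4.
  weight-recurrence : ∀ {d} → d ≤ 4 → weight d + d * decrement d + d * weight d ≤ W + d * (decrement d * d)
  weight-recurrence {d} d≤4 rewrite W≡850 = table {d} (s≤s d≤4)
    where
    table : ∀ {d} → d < 5 → weight d + d * decrement d + d * weight d ≤ 850 + d * (decrement d * d)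
    table = from-yes (allUpTo? (λ d → weight d + d * decrement d + d * weight d ≤? 850 + d * (decrement d * d)) 5)

  weight-antitone : ∀ {d e} → d ≤ e → e ≤ 4 → weight e ≤ weight d
  weight-antitone {d} {e} d≤e e≤4 = table {d} (s≤s (≤-trans d≤e e≤4)) {e} (s≤s e≤4) d≤e
    where
    table : ∀ {d} → d < 5 → ∀ {e} → e < 5 → d ≤ e → weight e ≤ weight d
    table = from-yes (allUpTo? (λ d → allUpTo? (λ e → (d ≤? e) →-dec (weight e ≤? weight d)) 5) 5)

  -- Shearer's lower bound on the independence number

  VSet : ℕ → Set
  VSet m = Fin m → Bool

  infix 4 _⊆ᵇ_
  _⊆ᵇ_ : ∀ {m} → VSet m → VSet m → Set
  I ⊆ᵇ S = ∀ v → I v ≡ true → S v ≡ true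

  true≢false : ∀ {b} → b ≡ true → b ≡ false → ⊥
  true≢false refl ()

  ⊆⇒ι≤ : ∀ {b c} → (b ≡ true → c ≡ true) → ι b ≤ ι c
  ⊆⇒ι≤ {false} _ = z≤n
  ⊆⇒ι≤ {true} b⇒c rewrite b⇒c refl = ≤-refl

  #-mono : ∀ {m} {A B : VSet m} → A ⊆ᵇ B → # A ≤ # B
  #-mono A⊆B = sum-mono (λ v → ⊆⇒ι≤ (A⊆B v))

  #>0⇒member : ∀ {m} (S : VSet m) → 1 ≤ # S → ∃[ v ] S v ≡ true
  #>0⇒member S S>0 with weighted-pigeonhole S (λ _ → 0) (λ _ → 0) S>0 ≤-refl
  ... | v , v∈S , _ = v , v∈S

  insert : ∀ {m} → Fin m → VSet m → VSet m
  insert v S u = does (u ≟ v) ∨ S u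

  ⊆-insert : ∀ {m} (v : Fin m) S → S ⊆ᵇ insert v S
  ⊆-insert v S u u∈S with u ≟ v
  ... | yes _ = refl
  ... | no _  = u∈S

  insert⁻ : ∀ {m} (v : Fin m) S u → insert v S u ≡ true → u ≡ v ⊎ S u ≡ true
  insert⁻ v S u u∈ with u ≟ v
  ... | yes u≡v = inj₁ u≡v
  ... | no _    = inj₂ u∈

  insert-⊆ : ∀ {m} (v : Fin m) {S T} → S ⊆ᵇ T → T v ≡ true → insert v S ⊆ᵇ T
  insert-⊆ v {S} S⊆T v∈T u u∈ with insert⁻ v S u u∈
  ... | inj₁ refl = v∈T
  ... | inj₂ u∈S  = S⊆T u u∈S

  #-insert : ∀ {m} (v : Fin m) (S : VSet m) → S v ≡ false → # insert v S ≡ 1 + # S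
  #-insert v S v∉S = trans (sum-cong lemma) (trans (sum-+ _ _) (cong (_+ # S) (sum-δ v)))
    where
    lemma : ∀ u → ι (insert v S u) ≡ δ v u + ι (S u)
    lemma u with u ≟ v
    ... | yes refl rewrite v∉S = refl
    ... | no _ = refl

  module _ (G : Graph) where
    open Graph G using (Vertex; _~_; _~?_; ~-sym; ~-irr)

    adj : Vertex → Vertex → ℕ
    adj u v = ι (does (u ~? v))

    adj≡1 : ∀ {u v} → u ~ v → adj u v ≡ 1
    adj≡1 {u} {v} u~v = cong ι (dec-true (u ~? v) u~v)

    adj≡0 : ∀ {u v} → ¬ u ~ v → adj u v ≡ 0
    adj≡0 {u} {v} u≁v = cong ι (dec-false (u ~? v) u≁v)

    adj-sym : ∀ u v → adj u v ≡ adj v u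
    adj-sym u v with u ~? v
    ... | yes u~v = sym (adj≡1 (~-sym u~v))
    ... | no u≁v  = sym (adj≡0 (λ v~u → u≁v (~-sym v~u)))

    adj-irr : ∀ v → adj v v ≡ 0
    adj-irr v = adj≡0 ~-irr

    deg : VSet (n G) → Vertex → ℕ
    deg S v = sum (λ u → ι (S u) * adj v u)

    MaxDeg≤4 : Set
    MaxDeg≤4 = ∀ v → sum (adj v) ≤ 4

    deg≤sum : ∀ S v → deg S v ≤ sum (adj v)
    deg≤sum S v = sum-mono lemma
      where
      lemma : ∀ u → ι (S u) * adj v u ≤ adj v u
      lemma u with S u
      ... | true  = ≤-reflexive (*-identityˡ (adj v u))
      ... | false = z≤n

    Indep : VSet (n G) → Set
    Indep I = ∀ u v → I u ≡ true → I v ≡ true → ¬ u ~ v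

    insert-indep : ∀ {v I} → Indep I → (∀ u → I u ≡ true → ¬ v ~ u) → Indep (insert v I)
    insert-indep {v} {I} ind v≁I x y x∈ y∈ x~y with insert⁻ v I x x∈ | insert⁻ v I y y∈
    ... | inj₁ refl | inj₁ refl = ~-irr x~y
    ... | inj₁ refl | inj₂ y∈I  = v≁I y y∈I x~y
    ... | inj₂ x∈I  | inj₁ refl = v≁I x x∈I (~-sym x~y)
    ... | inj₂ x∈I  | inj₂ y∈I  = ind x y x∈I y∈I x~y

    infixl 6 _∖N[_]
    _∖N[_] : VSet (n G) → Vertex → VSet (n G)
    (S ∖N[ v ]) u = S u ∧ not (does (u ≟ v)) ∧ not (does (v ~? u))

    ∖N⁻ : ∀ {S v u} → (S ∖N[ v ]) u ≡ true → S u ≡ true × u ≢ v × ¬ v ~ u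
    ∖N⁻ {S} {v} {u} u∈ with S u | u ≟ v | v ~? u
    ... | true | no u≢v | no v≁u = refl , u≢v , v≁u

    ∖N-⊆ : ∀ {S v} → S ∖N[ v ] ⊆ᵇ S
    ∖N-⊆ {S} {v} u u∈ = proj₁ (∖N⁻ {S} {v} {u} u∈)

    ι-∖N : ∀ S v u → S v ≡ true → ι (S u) ≡ δ v u + (ι (S u) * adj v u + ι ((S ∖N[ v ]) u))
    ι-∖N S v u v∈S with u ≟ v
    ι-∖N S v u v∈S | yes refl rewrite v∈S | adj-irr u = refl
    ι-∖N S v u v∈S | no _ with S u | v ~? u
    ... | true  | yes _ = refl
    ... | true  | no _  = refl
    ... | false | yes _ = refl
    ... | false | no _  = refl

    #-∖N : ∀ S v → S v ≡ true → # S ≡ 1 + (deg S v + # (S ∖N[ v ]))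
    #-∖N S v v∈S = trans (sum-cong (λ u → ι-∖N S v u v∈S))
      (trans (sum-+ _ _) (cong₂ _+_ (sum-δ v) (sum-+ _ _)))

    -- The common neighbours of `v` and `w` in `S`: what a `w` not adjacent to `v` loses from its
    -- degree when the closed neighbourhood of `v` goes.
    codeg : VSet (n G) → Vertex → Vertex → ℕ
    codeg S v w = sum (λ u → ι (S u) * (adj v u * adj w u))

    module Shearer (tf : TriangleFree G) (Δ≤4 : MaxDeg≤4) where

      deg≤4 : ∀ S v → deg S v ≤ 4
      deg≤4 S v = ≤-trans (deg≤sum S v) (Δ≤4 v)

      codeg-adjacent : ∀ S {v w} → v ~ w → codeg S v w ≡ 0
      codeg-adjacent S {v} {w} v~w = sum-≡0 lemma
        where
        lemma : ∀ u → ι (S u) * (adj v u * adj w u) ≡ 0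
        lemma u with v ~? u | w ~? u
        ... | yes v~u | yes w~u = contradiction (v~w , w~u , v~u) (tf v w u)
        ... | yes _   | no _    = *-zeroʳ (ι (S u))
        ... | no _    | _       = *-zeroʳ (ι (S u))

      codeg-refl : ∀ S v → codeg S v v ≡ deg S v
      codeg-refl S v = sum-cong lemma
        where
        lemma : ∀ u → ι (S u) * (adj v u * adj v u) ≡ ι (S u) * adj v u
        lemma u with v ~? u
        ... | yes _ = refl
        ... | no _  = refl

      deg-∖N : ∀ S v w → S v ≡ true → ¬ v ~ w → deg S w ≡ deg (S ∖N[ v ]) w + codeg S v w
      deg-∖N S v w v∈S v≁w = trans (sum-cong lemma) (sum-+ _ _)
        where
        lemma : ∀ u → ι (S u) * adj w u ≡ ι ((S ∖N[ v ]) u) * adj w u + ι (S u) * (adj v u * adj w u)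
        lemma u with u ≟ v
        lemma u | yes refl rewrite adj≡0 (λ w~u → v≁w (~-sym w~u)) with S u
        ... | true  = sym (cong (_+ 0) (*-zeroʳ (adj u u)))
        ... | false = refl
        lemma u | no _ with S u | v ~? u
        ... | true  | yes _ = sym (cong (_+ 0) (*-identityˡ (adj w u)))
        ... | true  | no _  = sym (+-identityʳ (adj w u + 0))
        ... | false | yes _ = refl
        ... | false | no _  = refl

      module _ (S : VSet (n G)) where
        private
          s : Vertex → ℕ
          s v = ι (S v)

          d : Vertex → ℕ
          d = deg S

        -- Deleting the closed neighbourhood of v costs at most loss v and pays for one vertex
        -- plus the raised weights at distance two; summed over S the gains win, so they win
        -- at some v.
        loss gain : Vertex → ℕ
        loss v = weight (d v) + d v * decrement (d v) + sum (λ w → s w * (adj v w * weight (d w)))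
        gain v = W + sum (λ w → s w * (codeg S v w * decrement (d w)))

        -- `gain` sums over all of `S`, not only over distance two. Neighbours of `v` contribute
        -- nothing, having codegree 0 by triangle-freeness, and the term at `v` itself, of codegree
        -- `d v`, is balanced by the summand `d v * decrement (d v)` of `loss`.
        potential-drop : ∀ v → S v ≡ true → loss v ≤ gain v →
          sum (λ w → s w * weight (d w)) ≤
          W + sum (λ w → ι ((S ∖N[ v ]) w) * weight (deg (S ∖N[ v ]) w))
        potential-drop v v∈S loss≤gain = +-cancelʳ-≤ C A (W + B) (begin
          A + C                                   ≡⟨ sum-+ _ _ ⟨
          sum (λ w → s w * weight (d w) + s w * (codeg S v w * decrement (d w))) ≤⟨ sum-mono pointwise ⟩
          sum (λ w → ι (S' w) * weight (deg S' w) + (δ v w * E + s w * (adj v w * weight (d w))))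
            ≡⟨ trans (sum-+ _ _) (cong (B +_) (trans (sum-+ _ _) (cong (_+ D) (sum-δ-* v (λ _ → E))))) ⟩
          B + loss v                              ≤⟨ +-monoʳ-≤ B loss≤gain ⟩
          B + (W + C)                           ≡⟨ rearrange W B C ⟩
          W + B + C                             ∎)
          where
          open ≤-Reasoning
          S' = S ∖N[ v ]
          A = sum (λ w → s w * weight (d w))
          B = sum (λ w → ι (S' w) * weight (deg S' w))
          C = sum (λ w → s w * (codeg S v w * decrement (d w)))
          D = sum (λ w → s w * (adj v w * weight (d w)))
          E = weight (d v) + d v * decrement (d v)
          rearrange : ∀ c x y → x + (c + y) ≡ c + x + y
          rearrange = solve-∀
          convex : ∀ w → ¬ v ~ w → weight (d w) + codeg S v w * decrement (d w) ≤ weight (deg S' w)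
          convex w v≁w with d w | deg-∖N S v w v∈S v≁w | deg≤4 S w
          ... | _ | refl | ≤4 = weight-convex {deg S' w} {codeg S v w} ≤4
          pointwise : ∀ w → s w * weight (d w) + s w * (codeg S v w * decrement (d w)) ≤
            ι (S' w) * weight (deg S' w) + (δ v w * E + s w * (adj v w * weight (d w)))
          pointwise w with w ≟ v
          pointwise w | yes refl rewrite v∈S | codeg-refl S v | +-identityʳ (weight (d v)) | +-identityʳ (d v * decrement (d v))
            | +-identityʳ E = m≤m+n E _
          pointwise w | no _ with S w
          ... | false = z≤n
          ... | true with v ~? w
          ...   | yes v~w rewrite codeg-adjacent S v~w = ≤-reflexive (drop (weight (d w)))
            where
            drop : ∀ x → 1 * x + 0 ≡ 1 * (1 * x)
            drop = solve-∀
          ...   | no v≁w = begin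
            1 * weight (d w) + 1 * (codeg S v w * decrement (d w)) ≡⟨ cong₂ _+_ (*-identityˡ (weight (d w))) (*-identityˡ _) ⟩
            weight (d w) + codeg S v w * decrement (d w)           ≤⟨ convex w v≁w ⟩
            weight (deg S' w)                              ≡⟨ pad (weight (deg S' w)) ⟩
            1 * weight (deg S' w) + 0                      ∎
            where
            pad : ∀ x → x ≡ 1 * x + 0
            pad = solve-∀

        -- Double counting turns each neighbour sum into `d v` times a vertex's own weight; the
        -- recurrence then removes the weights, and what remains is the comparison `walks`.
        sum-loss≤sum-gain : sum (λ v → s v * loss v) ≤ sum (λ v → s v * gain v)
        sum-loss≤sum-gain = begin
          sum (λ v → s v * loss v)
            ≡⟨ trans (sum-cong (λ v → *-distribˡ-+ (s v) _ _)) (sum-+ _ _) ⟩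
          sum (λ v → s v * (weight (d v) + d v * decrement (d v))) + sum (λ v → s v * sum (λ w → s w * (adj v w * weight (d w))))
            ≡⟨ cong (sum (λ v → s v * (weight (d v) + d v * decrement (d v))) +_) (neighbour-sum (λ w → weight (d w))) ⟩
          sum (λ v → s v * (weight (d v) + d v * decrement (d v))) + sum (λ v → s v * (d v * weight (d v)))
            ≡⟨ trans (sym (sum-+ _ _)) (sum-cong (λ v → sym (*-distribˡ-+ (s v) _ _))) ⟩
          sum (λ v → s v * (weight (d v) + d v * decrement (d v) + d v * weight (d v)))
            ≤⟨ sum-mono (λ v → *-monoʳ-≤ (s v) (weight-recurrence (deg≤4 S v))) ⟩
          sum (λ v → s v * (W + d v * (decrement (d v) * d v)))
            ≡⟨ trans (sum-cong (λ v → *-distribˡ-+ (s v) _ _)) (sum-+ _ _) ⟩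
          X + sum (λ v → s v * (d v * (decrement (d v) * d v)))
            ≤⟨ +-monoʳ-≤ X walks ⟩
          X + sum (λ v → s v * sum (λ w → s w * (codeg S v w * decrement (d w))))
            ≡⟨ trans (sym (sum-+ _ _)) (sum-cong (λ v → sym (*-distribˡ-+ (s v) _ _))) ⟩
          sum (λ v → s v * gain v) ∎
          where
          open ≤-Reasoning
          X = sum (λ v → s v * W)
          K : Vertex → Vertex → ℕ
          K u v = s u * (s v * adj u v)
          K-sym : ∀ u v → K u v ≡ K v u
          K-sym u v rewrite adj-sym u v = swap (s u) (s v) (adj v u)
            where
            swap : ∀ x y z → x * (y * z) ≡ y * (x * z)
            swap = solve-∀
          neighbour-sum : ∀ (h : Vertex → ℕ) →
            sum (λ v → s v * sum (λ w → s w * (adj v w * h w))) ≡ sum (λ w → s w * (d w * h w))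
          neighbour-sum h = begin-equality
            sum (λ v → s v * sum (λ w → s w * (adj v w * h w)))
              ≡⟨ sum-cong (λ v → sym (sum-*ˡ (s v) _)) ⟩
            sum (λ v → sum (λ w → s v * (s w * (adj v w * h w))))  ≡⟨ sum-swap _ ⟩
            sum (λ w → sum (λ v → s v * (s w * (adj v w * h w))))
              ≡⟨ sum-cong (λ w → trans (sum-cong (λ v → trans
                   (cong (λ z → s v * (s w * (z * h w))) (adj-sym v w)) (shuffle (s v) (s w) (adj w v) (h w))))
                   (sum-*ˡ (s w * h w) _)) ⟩
            sum (λ w → s w * h w * d w) ≡⟨ sum-cong (λ w → shuffle′ (s w) (h w) (d w)) ⟩
            sum (λ w → s w * (d w * h w)) ∎
            where
            shuffle : ∀ x y z t → x * (y * (z * t)) ≡ y * t * (x * z)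
            shuffle = solve-∀
            shuffle′ : ∀ x y z → x * y * z ≡ x * (z * y)
            shuffle′ = solve-∀
          opposite : ∀ u v → K u v * (decrement (d u) * d u + decrement (d v) * d v) ≤ K u v * (decrement (d u) * d v + decrement (d v) * d u)
          opposite u v = *-monoʳ-≤ (K u v) (decrement-opposite (deg≤4 S u) (deg≤4 S v))
          -- The right side is the sum over adjacent w, u of decrement(d w) · d u, since codegrees
          -- count walks of length two; the left has d w in place of d u. Degrees and decrements
          -- being oppositely ordered, the left is smaller.
          walks : sum (λ v → s v * (d v * (decrement (d v) * d v))) ≤
                  sum (λ v → s v * sum (λ w → s w * (codeg S v w * decrement (d w))))
          walks = begin
            sum (λ v → s v * (d v * (decrement (d v) * d v)))
              ≡⟨ sum-cong (λ v → trans (shuffle (s v) (d v) (decrement (d v) * d v)) (sym (sum-*ˡ (s v * (decrement (d v) * d v)) _))) ⟩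
            sum (λ v → sum (λ w → s v * (decrement (d v) * d v) * (s w * adj v w)))
              ≡⟨ sum-cong (λ v → sum-cong (λ w → shuffle₂ (s v) (decrement (d v) * d v) (s w) (adj v w))) ⟩
            sum (λ v → sum (λ w → K v w * (decrement (d v) * d v)))
              ≤⟨ chebyshev K d (λ v → decrement (d v)) K-sym opposite ⟩
            sum (λ v → sum (λ w → K v w * (decrement (d v) * d w)))
              ≡⟨ sum-cong (λ w → trans (sum-cong (λ u → shuffle₃ (s w) (s u) (adj w u) (decrement (d w)) (d u)))
                   (sum-*ˡ (s w * decrement (d w)) _)) ⟩
            sum (λ w → s w * decrement (d w) * sum (λ u → s u * (adj w u * d u)))
              ≡⟨ sum-cong (λ w → cong (s w * decrement (d w) *_) (sym (codegrees w))) ⟩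
            sum (λ w → s w * decrement (d w) * sum (λ v → s v * codeg S v w))
              ≡⟨ sum-cong (λ w → sym (sum-*ˡ (s w * decrement (d w)) _)) ⟩
            sum (λ w → sum (λ v → s w * decrement (d w) * (s v * codeg S v w)))
              ≡⟨ sum-swap _ ⟩
            sum (λ v → sum (λ w → s w * decrement (d w) * (s v * codeg S v w)))
              ≡⟨ sum-cong (λ v → trans (sum-cong (λ w → shuffle₄ (s w) (decrement (d w)) (s v) (codeg S v w)))
                   (sum-*ˡ (s v) _)) ⟩
            sum (λ v → s v * sum (λ w → s w * (codeg S v w * decrement (d w)))) ∎
            where
            shuffle : ∀ x y z → x * (y * z) ≡ x * z * y
            shuffle = solve-∀
            shuffle₂ : ∀ x y z t → x * y * (z * t) ≡ x * (z * t) * y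
            shuffle₂ = solve-∀
            shuffle₃ : ∀ x y z t u → x * (y * z) * (t * u) ≡ x * t * (y * (z * u))
            shuffle₃ = solve-∀
            shuffle₄ : ∀ x y z t → x * y * (z * t) ≡ z * (x * (t * y))
            shuffle₄ = solve-∀
            codegrees : ∀ w → sum (λ v → s v * codeg S v w) ≡ sum (λ u → s u * (adj w u * d u))
            codegrees w = begin-equality
              sum (λ v → s v * codeg S v w) ≡⟨ sum-cong (λ v → sym (sum-*ˡ (s v) _)) ⟩
              sum (λ v → sum (λ u → s v * (s u * (adj v u * adj w u)))) ≡⟨ sum-swap _ ⟩
              sum (λ u → sum (λ v → s v * (s u * (adj v u * adj w u))))
                ≡⟨ sum-cong (λ u → trans (sum-cong (λ v → trans
                     (cong (λ z → s v * (s u * (z * adj w u))) (adj-sym v u))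
                     (shuffle₅ (s v) (s u) (adj u v) (adj w u)))) (sum-*ˡ (s u * adj w u) _)) ⟩
              sum (λ u → s u * adj w u * d u) ≡⟨ sum-cong (λ u → *-assoc (s u) _ _) ⟩
              sum (λ u → s u * (adj w u * d u)) ∎
              where
              shuffle₅ : ∀ x y z t → x * (y * (z * t)) ≡ y * t * (x * z)
              shuffle₅ = solve-∀

      -- Greedy choice: a vertex whose gain covers its loss enters the set, its closed neighbourhood
      -- is deleted, and the potential drops by at most `W`.
      shearer : ∀ S → ∃[ I ] Indep I × I ⊆ᵇ S × sum (λ v → ι (S v) * weight (deg S v)) ≤ W * # I
      shearer S = go (# S) S ≤-refl
        where
        go : ∀ k S → # S ≤ k → ∃[ I ] Indep I × I ⊆ᵇ S × sum (λ v → ι (S v) * weight (deg S v)) ≤ W * # I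
        go k S #S≤k with 1 ≤? # S
        ... | no #S≱1 = (λ _ → false) , (λ _ _ ()) , (λ _ ()) , subst (_≤ _) (sym S-empty) z≤n
          where
          S-empty : sum (λ v → ι (S v) * weight (deg S v)) ≡ 0
          S-empty = sum-≡0 lemma
            where
            lemma : ∀ v → ι (S v) * weight (deg S v) ≡ 0
            lemma v with S v in eq
            ... | true  = contradiction (member⇒#>0 S v eq) #S≱1
            ... | false = refl
        go zero S #S≤k | yes #S≥1 = contradiction (≤-trans #S≥1 #S≤k) λ ()
        go (suc k) S #S≤k | yes #S≥1
          with weighted-pigeonhole S (loss S) (gain S) #S≥1 (sum-loss≤sum-gain S)
        ... | v , v∈S , loss≤gain
          with go k (S ∖N[ v ]) (s≤s⁻¹ (≤-trans (≤-trans (s≤s (m≤n+m _ (deg S v))) (≤-reflexive (sym (#-∖N S v v∈S)))) #S≤k))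
        ... | I , ind , I⊆ , bound = insert v I
            , insert-indep ind (λ u u∈I → proj₂ (proj₂ (∖N⁻ {S} (I⊆ u u∈I))))
            , insert-⊆ v (λ u u∈I → ∖N-⊆ {S} {v} u (I⊆ u u∈I)) v∈S
            , ≤-trans (potential-drop S v v∈S loss≤gain) (≤-trans (+-monoʳ-≤ W bound) (≤-reflexive eq))
          where
          v∉I : I v ≡ false
          v∉I with I v in v∈I
          ... | false = refl
          ... | true  = contradiction refl (proj₁ (proj₂ (∖N⁻ {S} (I⊆ v v∈I))))
          eq : W + W * # I ≡ W * # insert v I
          eq = trans (sym (*-suc W (# I))) (cong (W *_) (sym (#-insert v I v∉I)))

  -- Matchings as involutions, and Gallai's lemma

  any-vec? : ∀ {k m} {P : Vec (Fin m) k → Set} → (∀ xs → Dec (P xs)) → Dec (∃ P)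
  any-vec? {zero} P? = map′ (λ p → [] , p) (λ where ([] , p) → p) (P? [])
  any-vec? {suc k} P? = map′ (λ (x , xs , p) → x ∷ xs , p) (λ where (x ∷ xs , p) → x , xs , p)
    (any? (λ x → any-vec? (λ xs → P? (x ∷ xs))))

  -- Functions are searched through their value tables, with which they agree only pointwise; hence
  -- the condition that `P` respects pointwise equality.
  any-function? : ∀ {k m} {P : (Fin k → Fin m) → Set} →
    (∀ {f h} → (∀ i → f i ≡ h i) → P f → P h) → (∀ f → Dec (P f)) → Dec (∃ P)
  any-function? {P = P} resp P? = map′ (λ (xs , p) → Vec.lookup xs , p)
    (λ (f , p) → Vec.tabulate f , resp (λ i → sym (lookup∘tabulate f i)) p)
    (any-vec? (λ xs → P? (Vec.lookup xs)))

  module _ (G : Graph) where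
    open Graph G using (Vertex; _~_; _~?_; ~-sym; ~-irr)

    -- Fixed points are the missed vertices. Membership in `S` is stated for `v` and passes to its
    -- partner by involutivity.
    IsMatching : VSet (n G) → (Vertex → Vertex) → Set
    IsMatching S m = (∀ v → m (m v) ≡ v) × (∀ v → m v ≢ v → S v ≡ true × v ~ m v)

    cov : (Vertex → Vertex) → ℕ
    cov m = # (λ v → not (does (m v ≟ v)))

    isMatching? : ∀ S m → Dec (IsMatching S m)
    isMatching? S m = all? (λ v → m (m v) ≟ v) ×-dec
      all? (λ v → ¬? (m v ≟ v) →-dec ((S v Bool.≟ true) ×-dec (v ~? m v)))

    isMatching-resp : ∀ {S f h} → (∀ v → f v ≡ h v) → IsMatching S f → IsMatching S h
    isMatching-resp {S} {f} {h} f≗h (invol , edge) =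
      (λ v → trans (sym (f≗h (h v))) (trans (cong f (sym (f≗h v))) (invol v))) ,
      (λ v hv≢v → subst (λ w → S v ≡ true × v ~ w) (f≗h v) (edge v (hv≢v ∘ trans (sym (f≗h v)))))

    isMatching-mono : ∀ {S T m} → S ⊆ᵇ T → IsMatching S m → IsMatching T m
    isMatching-mono S⊆T (invol , edge) = invol ,
      λ v mv≢v → S⊆T v (proj₁ (edge v mv≢v)) , proj₂ (edge v mv≢v)

    cov-resp : ∀ {f h} → (∀ v → f v ≡ h v) → cov f ≡ cov h
    cov-resp f≗h = sum-cong (λ v → cong (λ w → ι (not (does (w ≟ v)))) (f≗h v))

    ι-cov-≢ : ∀ {m : Vertex → Vertex} {v} → m v ≢ v → ι (not (does (m v ≟ v))) ≡ 1
    ι-cov-≢ {m} {v} mv≢v = cong (ι ∘ not) (dec-false (m v ≟ v) mv≢v)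

    ι-cov-≡ : ∀ {m : Vertex → Vertex} {v} → m v ≡ v → ι (not (does (m v ≟ v))) ≡ 0
    ι-cov-≡ {m} {v} mv≡v = cong (ι ∘ not) (dec-true (m v ≟ v) mv≡v)

    id-isMatching : ∀ {S} → IsMatching S (λ v → v)
    id-isMatching = (λ _ → refl) , (λ _ v≢v → contradiction refl v≢v)

    cov≤#S : ∀ {S m} → IsMatching S m → cov m ≤ # S
    cov≤#S {S} {m} (_ , edge) = sum-mono (λ v → ⊆⇒ι≤ (lemma v))
      where
      lemma : ∀ v → not (does (m v ≟ v)) ≡ true → S v ≡ true
      lemma v cv with m v ≟ v
      ... | no mv≢v = proj₁ (edge v mv≢v)

    #≤n : ∀ (S : VSet (n G)) → # S ≤ # (λ (_ : Vertex) → true)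
    #≤n S = #-mono {B = λ _ → true} (λ _ _ → refl)

    edgeCount : (Vertex → Vertex) → ℕ
    edgeCount m = sum (λ u → ι (does (u Fin.<? m u)))

    -- Each matching edge is met at its smaller and at its larger end, and the substitution of `m u`
    -- for `u` exchanges the two counts.
    cov-even : ∀ {S m} → IsMatching S m → cov m ≡ 2 * edgeCount m
    cov-even {S} {m} (invol , _) = begin
      cov m                                               ≡⟨ sum-cong split ⟩
      sum (λ u → below u + above u)                       ≡⟨ sum-+ below above ⟩
      sum below + sum above                               ≡⟨ cong (sum below +_) flip ⟩
      sum below + sum below                               ≡⟨ cong (sum below +_) (sym (+-identityʳ _)) ⟩
      2 * sum below                                       ∎
      where
      open ≡-Reasoning
      below above : Vertex → ℕ
      below u = ι (does (u Fin.<? m u))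
      above u = ι (does (m u Fin.<? u))
      split : ∀ u → ι (not (does (m u ≟ u))) ≡ below u + above u
      split u with m u ≟ u
      ... | yes eq = sym (cong₂ _+_ (cong ι (dec-false (u Fin.<? m u) (Fin.<-irrefl (sym eq))))
                                    (cong ι (dec-false (m u Fin.<? u) (Fin.<-irrefl eq))))
      ... | no mu≢u with Fin.<-cmp u (m u)
      ...   | tri< u<mu _ mu≮u = sym (cong₂ _+_ (cong ι (dec-true (u Fin.<? m u) u<mu))
                                                (cong ι (dec-false (m u Fin.<? u) mu≮u)))
      ...   | tri≈ _ eq _      = contradiction (sym eq) mu≢u
      ...   | tri> u≮mu _ mu<u = sym (cong₂ _+_ (cong ι (dec-false (u Fin.<? m u) u≮mu))
                                                (cong ι (dec-true (m u Fin.<? u) mu<u)))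
      δ-invol : ∀ u v → δ (m u) v ≡ δ (m v) u
      δ-invol u v with v ≟ m u | u ≟ m v
      ... | yes _  | yes _  = refl
      ... | no _   | no _   = refl
      ... | yes eq | no ne  = contradiction (trans (sym (invol u)) (cong m (sym eq))) ne
      ... | no ne  | yes eq = contradiction (trans (sym (invol v)) (cong m (sym eq))) ne
      flip : sum above ≡ sum below
      flip = begin
        sum above
          ≡⟨ sum-cong (λ u → sym (sum-δ-* (m u) (λ v → ι (does (v Fin.<? u))))) ⟩
        sum (λ u → sum (λ v → δ (m u) v * ι (does (v Fin.<? u))))  ≡⟨ sum-swap _ ⟩
        sum (λ v → sum (λ u → δ (m u) v * ι (does (v Fin.<? u))))
          ≡⟨ sum-cong (λ v → sum-cong (λ u → cong (_* ι (does (v Fin.<? u))) (δ-invol u v))) ⟩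
        sum (λ v → sum (λ u → δ (m v) u * ι (does (v Fin.<? u))))
          ≡⟨ sum-cong (λ v → sum-δ-* (m v) (λ u → ι (does (v Fin.<? u)))) ⟩
        sum below ∎

    -- The elementary exchange: `x` takes `y` and the old partner of `y` is released. For a missed
    -- `x` it augments if `y` is missed too, and otherwise moves the missed vertex from `x` to
    -- `m y`.
    rematch : Vertex → Vertex → (Vertex → Vertex) → Vertex → Vertex
    rematch x y m w with w ≟ x | w ≟ y | w ≟ m y
    ... | yes _ | _     | _     = y
    ... | no _  | yes _ | _     = x
    ... | no _  | no _  | yes _ = w
    ... | no _  | no _  | no _  = m w

    module Rematch {S x y m} (M : IsMatching S m) (x∈S : S x ≡ true) (y∈S : S y ≡ true)
                   (x~y : x ~ y) (mx≡x : m x ≡ x) where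
      private
        invol = proj₁ M
        m′ = rematch x y m

      x≢y : x ≢ y
      x≢y refl = ~-irr x~y

      my≢x : m y ≢ x
      my≢x my≡x = x≢y (sym (trans (sym (invol y)) (trans (cong m my≡x) mx≡x)))

      at-x : m′ x ≡ y
      at-x with x ≟ x
      ... | yes _ = refl
      ... | no ne = contradiction refl ne

      at-y : m′ y ≡ x
      at-y with y ≟ x | y ≟ y
      ... | yes eq | _     = contradiction (sym eq) x≢y
      ... | no _   | yes _ = refl
      ... | no _   | no ne = contradiction refl ne

      at-my : m y ≢ y → m′ (m y) ≡ m y
      at-my my≢y with m y ≟ x | m y ≟ y | m y ≟ m y
      ... | yes eq | _      | _     = contradiction eq my≢x
      ... | no _   | yes eq | _     = contradiction eq my≢y
      ... | no _   | no _   | yes _ = refl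
      ... | no _   | no _   | no ne = contradiction refl ne

      elsewhere : ∀ {w} → w ≢ x → w ≢ y → w ≢ m y → m′ w ≡ m w
      elsewhere {w} w≢x w≢y w≢my with w ≟ x | w ≟ y | w ≟ m y
      ... | yes eq | _      | _      = contradiction eq w≢x
      ... | no _   | yes eq | _      = contradiction eq w≢y
      ... | no _   | no _   | yes eq = contradiction eq w≢my
      ... | no _   | no _   | no _   = refl

      data View (w : Vertex) : Set where
        is-x  : w ≡ x → View w
        is-y  : w ≡ y → View w
        is-my : w ≢ x → w ≢ y → w ≡ m y → View w
        other : w ≢ x → w ≢ y → w ≢ m y → View w

      view : ∀ w → View w
      view w with w ≟ x | w ≟ y | w ≟ m y
      ... | yes p | _     | _     = is-x p
      ... | no _  | yes p | _     = is-y p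
      ... | no p  | no q  | yes r = is-my p q r
      ... | no p  | no q  | no r  = other p q r

      isMatching : IsMatching S m′
      isMatching = invol′ , edge′
        where
        invol′ : ∀ w → m′ (m′ w) ≡ w
        invol′ w with view w
        ... | is-x refl = trans (cong m′ at-x) at-y
        ... | is-y refl = trans (cong m′ at-y) at-x
        ... | is-my _ w≢y refl = trans (cong m′ (at-my w≢y)) (at-my w≢y)
        ... | other w≢x w≢y w≢my = trans (cong m′ (elsewhere w≢x w≢y w≢my)) (trans
          (elsewhere (λ eq → w≢x (trans (back eq) mx≡x)) (λ eq → w≢my (back eq))
            (λ eq → w≢y (trans (back eq) (invol y)))) (invol w))
          where
          back : ∀ {z} → m w ≡ z → w ≡ m z
          back eq = trans (sym (invol w)) (cong m eq)
        edge′ : ∀ w → m′ w ≢ w → S w ≡ true × w ~ m′ w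
        edge′ w m′w≢w with view w
        ... | is-x refl = x∈S , subst (w ~_) (sym at-x) x~y
        ... | is-y refl = y∈S , subst (w ~_) (sym at-y) (~-sym x~y)
        ... | is-my _ w≢y refl = contradiction (at-my w≢y) m′w≢w
        ... | other w≢x w≢y w≢my rewrite elsewhere w≢x w≢y w≢my = proj₂ M w m′w≢w

      cov-augment : m y ≡ y → suc (cov m) ≤ cov m′
      cov-augment my≡y = subst (_≤ cov m′)
        (trans (sum-+ _ _) (trans (cong (cov m +_) (sum-δ x)) (+-comm (cov m) 1)))
        (sum-mono lemma)
        where
        lemma : ∀ w → ι (not (does (m w ≟ w))) + δ x w ≤ ι (not (does (m′ w ≟ w)))
        lemma w with view w
        ... | is-x refl rewrite ι-cov-≡ {m} mx≡x | δ-refl w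
              | ι-cov-≢ {m′} {w} (λ eq → x≢y (trans (sym eq) at-x)) = ≤-refl
        ... | is-y refl rewrite ι-cov-≡ {m} my≡y | δ-≢ {v = x} {w} (x≢y ∘ sym) = z≤n
        ... | is-my _ w≢y refl = contradiction my≡y w≢y
        ... | other w≢x w≢y w≢my rewrite elsewhere w≢x w≢y w≢my | δ-≢ w≢x = ≤-reflexive (+-identityʳ _)

      cov-shift : m y ≢ y → cov m′ ≡ cov m
      cov-shift my≢y = +-cancelʳ-≡ 1 _ _ (trans (cong (cov m′ +_) (sym (sum-δ (m y))))
        (trans (sym (sum-+ _ _)) (trans (sum-cong lemma) (trans (sum-+ _ _) (cong (cov m +_) (sum-δ x))))))
        where
        lemma : ∀ w → ι (not (does (m′ w ≟ w))) + δ (m y) w ≡ ι (not (does (m w ≟ w))) + δ x w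
        lemma w with view w
        ... | is-x refl rewrite ι-cov-≡ {m} mx≡x | δ-refl w | δ-≢ {v = m y} {w} (my≢x ∘ sym)
              | ι-cov-≢ {m′} {w} (λ eq → x≢y (trans (sym eq) at-x)) = refl
        ... | is-y refl rewrite ι-cov-≢ {m} my≢y | δ-≢ {v = x} {w} (x≢y ∘ sym) | δ-≢ {v = m w} {w} (my≢y ∘ sym)
              | ι-cov-≢ {m′} {w} (λ eq → x≢y (trans (sym at-y) eq)) = refl
        ... | is-my w≢x _ refl rewrite ι-cov-≡ {m′} (at-my my≢y) | δ-refl w | δ-≢ w≢x
              | ι-cov-≢ {m} {w} (λ eq → my≢y (trans (sym eq) (invol y))) = refl
        ... | other w≢x w≢y w≢my rewrite elsewhere w≢x w≢y w≢my | δ-≢ w≢x | δ-≢ w≢my = refl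

    agreement : (Vertex → Vertex) → (Vertex → Vertex) → ℕ
    agreement m₁ m₂ = # (λ v → does (m₁ v ≟ m₂ v))

    -- c is the number of vertices covered by a maximum matching of S.
    module Gallai (S : VSet (n G)) (c : ℕ) (c-max : ∀ m → IsMatching S m → cov m ≤ c) where

      Maximum : (Vertex → Vertex) → Set
      Maximum m = IsMatching S m × cov m ≡ c

      -- The relation of Gallai's argument: adjacency implies it, and transitivity spreads it along
      -- paths.
      Linked : Vertex → Vertex → Set
      Linked u v = ∀ m → Maximum m → m u ≡ u → m v ≡ v → u ≡ v

      adjacent⇒linked : ∀ {u v} → S u ≡ true → S v ≡ true → u ~ v → Linked u v
      adjacent⇒linked u∈S v∈S u~v m (M , refl) mu≡u mv≡v =
        contradiction (≤-trans (cov-augment mv≡v) (c-max _ isMatching)) (<-irrefl refl)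
        where open Rematch M u∈S v∈S u~v mu≡u

      -- If m₁ misses u and v while m₂ misses t and covers u and v, then m₁ covers
      -- some x ≠ t missed by m₂; rotating m₂ along the m₁-edge at x keeps t uncovered
      -- and brings m₂ closer to m₁.
      linked-trans : ∀ {u t v} → (∃[ m ] Maximum m × m t ≡ t) →
                     Linked u t → Linked t v → Linked u v
      linked-trans {u} {t} {v} (m₂ , M₂ , m₂t≡t) u-t t-v m₁ M₁@((invol₁ , edge₁) , cov₁) m₁u≡u m₁v≡v =
        decidable-stable (u ≟ v) (λ u≢v → rotate u≢v (suc (n G)) m₂ M₂ m₂t≡t (m≤n+m _ _))
        where
        -- Every rotation raises the agreement, which never exceeds the number of vertices; `k` is
        -- the room that is left.
        rotate : u ≢ v → ∀ k m₂ → Maximum m₂ → m₂ t ≡ t → suc (n G) ≤ agreement m₁ m₂ + k → ⊥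
        rotate u≢v zero m₂ M₂ m₂t≡t n<agree = contradiction n<agree (<⇒≱ (s≤s (begin
          agreement m₁ m₂ + 0          ≡⟨ +-identityʳ _ ⟩
          agreement m₁ m₂              ≤⟨ #≤n _ ⟩
          # (λ (_ : Vertex) → true)    ≡⟨ trans (sum-const (n G) 1) (*-identityʳ _) ⟩
          n G                          ∎)))
          where open ≤-Reasoning
        rotate u≢v (suc k) m₂ M₂@(m₂-matching , cov₂) m₂t≡t n≤agree with m₂ u ≟ u | m₂ v ≟ v
        -- If `m₂` misses `u` or `v` along with `t`, that vertex is `t` by its link; then `m₁`
        -- misses `t` and the other one, and the second link closes the case.
        ... | yes m₂u≡u | _ = u≢v (trans u≡t (t-v m₁ M₁ (subst (λ w → m₁ w ≡ w) u≡t m₁u≡u) m₁v≡v))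
          where u≡t = u-t m₂ M₂ m₂u≡u m₂t≡t
        ... | no _ | yes m₂v≡v = u≢v (trans (u-t m₁ M₁ m₁u≡u (subst (λ w → m₁ w ≡ w) (sym t≡v) m₁v≡v)) t≡v)
          where t≡v = t-v m₂ M₂ m₂t≡t m₂v≡v
        ... | no m₂u≢u | no m₂v≢v
          with any? (λ x → ¬? (x ≟ t) ×-dec (m₂ x ≟ x) ×-dec ¬? (m₁ x ≟ x))
        -- Both matchings cover `c` vertices. As `u` and `v` are covered by `m₂` alone, at least two
        -- vertices are covered by `m₁` alone, and one of these differs from `t`.
        ...   | no none = contradiction counts (<⇒≱ (+-monoʳ-< c (s≤s (s≤s z≤n))))
          where
          pointwise : ∀ w → ι (not (does (m₁ w ≟ w))) + (δ u w + δ v w) ≤ ι (not (does (m₂ w ≟ w))) + δ t w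
          pointwise w with w ≟ u | w ≟ v
          ... | yes refl | yes eq = contradiction eq u≢v
          ... | yes refl | no _ rewrite ι-cov-≡ {m₁} m₁u≡u | ι-cov-≢ {m₂} m₂u≢u = s≤s z≤n
          ... | no _ | yes refl rewrite ι-cov-≡ {m₁} m₁v≡v | ι-cov-≢ {m₂} m₂v≢v = s≤s z≤n
          ... | no _ | no _ with m₁ w ≟ w | m₂ w ≟ w | w ≟ t
          ...   | yes _  | _      | _      = z≤n
          ...   | no _   | no _   | _      = s≤s z≤n
          ...   | no _   | yes _  | yes _  = s≤s z≤n
          ...   | no ne  | yes eq | no w≢t = contradiction (w , w≢t , eq , ne) none
          counts : c + 2 ≤ c + 1
          counts = subst₂ _≤_
            (trans (sum-+ _ _) (cong₂ _+_ cov₁ (trans (sum-+ _ _) (cong₂ _+_ (sum-δ u) (sum-δ v)))))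
            (trans (sum-+ _ _) (cong₂ _+_ cov₂ (sum-δ t)))
            (sum-mono pointwise)
        ...   | yes (x , x≢t , m₂x≡x , m₁x≢x) with m₂ (m₁ x) ≟ m₁ x
        -- With `x` and its `m₁`-partner both missed, `m₂` could be augmented.
        ...     | yes m₂y≡y = contradiction (≤-trans (cov-augment m₂y≡y) (c-max _ isMatching))
                                (<⇒≱ (s≤s (≤-reflexive (sym cov₂))))
          where
          y≢ : m₁ (m₁ x) ≢ m₁ x
          y≢ eq = m₁x≢x (sym (trans (sym (invol₁ x)) eq))
          open Rematch {y = m₁ x} m₂-matching (proj₁ (edge₁ x m₁x≢x)) (proj₁ (edge₁ (m₁ x) y≢)) (proj₂ (edge₁ x m₁x≢x)) m₂x≡x
        ...     | no m₂y≢y = rotate u≢v k (rematch x (m₁ x) m₂)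
                    (isMatching , trans (cov-shift m₂y≢y) cov₂) (trans (elsewhere t≢x t≢y t≢m₂y) m₂t≡t)
                    (≤-trans n≤agree (≤-trans (≤-reflexive (+-suc _ k)) (+-monoˡ-≤ k agree<)))
          where
          y = m₁ x
          y≢ : m₁ y ≢ y
          y≢ eq = m₁x≢x (sym (trans (sym (invol₁ x)) eq))
          open Rematch {y = y} m₂-matching (proj₁ (edge₁ x m₁x≢x)) (proj₁ (edge₁ y y≢)) (proj₂ (edge₁ x m₁x≢x)) m₂x≡x
          t≢x : t ≢ x
          t≢x = x≢t ∘ sym
          t≢y : t ≢ y
          t≢y refl = m₂y≢y m₂t≡t
          t≢m₂y : t ≢ m₂ y
          t≢m₂y eq = t≢y (trans (sym m₂t≡t) (trans (cong m₂ eq) (proj₁ m₂-matching y)))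
          -- Agreement is gained at `x` and lost nowhere: `m₁` sends `y` to `x`, so it differed from
          -- `m₂` both at `y` and at `m₂ y`.
          agree< : suc (agreement m₁ m₂) ≤ agreement m₁ (rematch x y m₂)
          agree< = subst (_≤ agreement m₁ (rematch x y m₂))
            (trans (sum-+ _ _) (trans (cong (agreement m₁ m₂ +_) (sum-δ x)) (+-comm _ 1)))
            (sum-mono lemma)
            where
            lemma : ∀ w → ι (does (m₁ w ≟ m₂ w)) + δ x w ≤ ι (does (m₁ w ≟ rematch x y m₂ w))
            lemma w with view w
            ... | is-x refl rewrite dec-false (m₁ w ≟ m₂ w) (λ eq → m₁x≢x (trans eq m₂x≡x)) | δ-refl w
                  | dec-true (m₁ w ≟ rematch x y m₂ w) (sym at-x) = ≤-refl
            ... | is-y refl rewrite dec-false (m₁ w ≟ m₂ w) (λ eq → my≢x (trans (sym eq) (invol₁ x)))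
                  | δ-≢ {v = x} {w} m₁x≢x = z≤n
            ... | is-my w≢x _ refl rewrite δ-≢ w≢x
                  | dec-false (m₁ w ≟ m₂ w) (λ eq → w≢x (trans (sym (invol₁ w))
                      (trans (cong m₁ (trans eq (proj₁ m₂-matching y))) (invol₁ x)))) = z≤n
            ... | other w≢x w≢y w≢my rewrite elsewhere w≢x w≢y w≢my | δ-≢ w≢x = ≤-reflexive (+-identityʳ _)

      -- Every vertex can be missed, so links compose along paths in `S` and any two of its vertices
      -- are linked. A maximum matching that misses `v` then misses no other vertex of `S`.
      gallai : ∀ {r} → (∀ u → S u ≡ true → Star (λ x y → x ~ y × S y ≡ true) r u) → S r ≡ true →
        (∀ t → S t ≡ true → ∃[ m ] Maximum m × m t ≡ t) → ∀ {m} → Maximum m → # S ≤ c + 1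
      gallai {r} connected r∈S missable {m} M@(_ , cov≡c) with any? (λ v → (S v Bool.≟ true) ×-dec (m v ≟ v))
      ... | no none = ≤-trans (sum-mono lemma) (≤-trans (≤-reflexive cov≡c) (m≤m+n c 1))
        where
        lemma : ∀ v → ι (S v) ≤ ι (not (does (m v ≟ v)))
        lemma v with S v in eq | m v ≟ v
        ... | false | _        = z≤n
        ... | true  | no _     = ≤-refl
        ... | true  | yes mv≡v = contradiction (v , eq , mv≡v) none
      ... | yes (v , v∈S , mv≡v) = subst (# S ≤_) (trans (sum-+ _ _) (cong₂ _+_ cov≡c (sum-δ v))) (sum-mono lemma)
        where
        linked-path : ∀ {u w} → S u ≡ true → Star (λ x y → x ~ y × S y ≡ true) u w → Linked u w
        linked-path u∈S ε = λ _ _ _ _ → refl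
        linked-path u∈S ((u~x , x∈S) ◅ path) =
          linked-trans (missable _ x∈S) (adjacent⇒linked u∈S x∈S u~x) (linked-path x∈S path)
        linked : ∀ w → S w ≡ true → Linked v w
        linked w w∈S = linked-trans (missable r r∈S)
          (λ m M mv≡v mr≡r → sym (linked-path r∈S (connected v v∈S) m M mr≡r mv≡v))
          (linked-path r∈S (connected w w∈S))
        lemma : ∀ w → ι (S w) ≤ ι (not (does (m w ≟ w))) + δ v w
        lemma w with S w in eq | m w ≟ w
        ... | false | _        = z≤n
        ... | true  | no _     = s≤s z≤n
        ... | true  | yes mw≡w rewrite linked w eq m M mv≡v mw≡w | δ-refl w = ≤-refl

    -- Exhaustive search replaces the matching by a larger one as long as there is one; `# S` bounds
    -- the number of rounds.
    maximum-matching : ∀ S → ∃[ M ] IsMatching S M × (∀ m → IsMatching S m → cov m ≤ cov M)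
    maximum-matching S = search (# S) (λ v → v) id-isMatching (m≤n+m _ _)
      where
      search : ∀ k M → IsMatching S M → # S ≤ cov M + k →
        ∃[ M ] IsMatching S M × (∀ m → IsMatching S m → cov m ≤ cov M)
      search k M isM bound
        with any-function? {P = λ m → IsMatching S m × suc (cov M) ≤ cov m}
               (λ eq (m , lt) → isMatching-resp eq m , subst (suc (cov M) ≤_) (cov-resp eq) lt)
               (λ m → isMatching? S m ×-dec (suc (cov M) ≤? cov m))
      ... | no none = M , isM , λ m isM′ → ≮⇒≥ (λ lt → none (m , isM′ , lt))
      search zero M isM bound | yes (m , isM′ , lt) =
        contradiction (≤-trans lt (≤-trans (cov≤#S isM′) (≤-trans bound (≤-reflexive (+-identityʳ _))))) (<-irrefl refl)
      search (suc k) M isM bound | yes (m , isM′ , lt) =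
        search k m isM′ (≤-trans bound (≤-trans (≤-reflexive (+-suc _ k)) (+-monoˡ-≤ k lt)))

    missed? : ∀ S c t → Dec (∃[ m ] (IsMatching S m × cov m ≡ c) × m t ≡ t)
    missed? S c t = any-function?
      (λ {f} {h} eq ((isM , cov≡c) , ft≡t) →
        (isMatching-resp eq isM , trans (sym (cov-resp eq)) cov≡c) , trans (sym (eq t)) ft≡t)
      (λ m → (isMatching? S m ×-dec (cov m ℕ.≟ c)) ×-dec (m t ≟ t))

  -- The bound for vertex sets of a fixed graph

  any-set? : ∀ {m} {P : VSet m → Set} →
    (∀ {A B} → (∀ v → A v ≡ B v) → P A → P B) → (∀ A → Dec (P A)) → Dec (∃ P)
  any-set? {P = P} resp P? = map′ (λ (xs , p) → Vec.lookup xs , p)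
    (λ (A , p) → Vec.tabulate A , resp (λ i → sym (lookup∘tabulate A i)) p)
    (anySubset? (λ xs → P? (Vec.lookup xs)))

  infixl 6 _∖_
  _∖_ : ∀ {m} → VSet m → VSet m → VSet m
  (S ∖ C) v = S v ∧ not (C v)

  ∖⁻ : ∀ {m} (S C : VSet m) v → (S ∖ C) v ≡ true → S v ≡ true × C v ≡ false
  ∖⁻ S C v v∈ with S v | C v
  ... | true | false = refl , refl

  ∖⁺ : ∀ {m} (S C : VSet m) v → S v ≡ true → C v ≡ false → (S ∖ C) v ≡ true
  ∖⁺ S C v v∈S v∉C rewrite v∈S | v∉C = refl

  ∖-⊆ : ∀ {m} (S C : VSet m) → S ∖ C ⊆ᵇ S
  ∖-⊆ S C v v∈ = proj₁ (∖⁻ S C v v∈)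

  #-∖ : ∀ {m} (S C : VSet m) → C ⊆ᵇ S → # S ≡ # C + # (S ∖ C)
  #-∖ S C C⊆S = trans (sum-cong lemma) (sum-+ _ _)
    where
    lemma : ∀ v → ι (S v) ≡ ι (C v) + ι ((S ∖ C) v)
    lemma v with C v in v∈C
    ... | true rewrite C⊆S v v∈C = refl
    ... | false with S v
    ...   | true  = refl
    ...   | false = refl

  #-∖-≤ : ∀ {m} (S C : VSet m) r {k} → C ⊆ᵇ S → C r ≡ true → # S ≤ suc k → # (S ∖ C) ≤ k
  #-∖-≤ S C r C⊆S r∈C #S≤ = s≤s⁻¹ (≤-trans (+-monoˡ-≤ (# (S ∖ C)) (member⇒#>0 C r r∈C))
    (≤-trans (≤-reflexive (sym (#-∖ S C C⊆S))) #S≤))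

  ⁅_⁆ : ∀ {m} → Fin m → VSet m
  ⁅ v ⁆ u = does (u ≟ v)

  ⁅⁆-⊆ : ∀ {m} {v : Fin m} {S} → S v ≡ true → ⁅ v ⁆ ⊆ᵇ S
  ⁅⁆-⊆ {v = v} v∈S u u∈ with u ≟ v
  ... | yes refl = v∈S

  v∈⁅v⁆ : ∀ {m} (v : Fin m) → ⁅ v ⁆ v ≡ true
  v∈⁅v⁆ v = dec-true (v ≟ v) refl

  #-size-bound : ∀ {n a} → 254 * n ≤ 850 * a → 7 * a ≤ 2 * n + 2 → n < 22
  #-size-bound {n} {a} n≤a a≤n = ≰⇒> λ 22≤n →
    contradiction (≤-trans (*-monoʳ-≤ 78 22≤n) small) (from-yes (¬? (78 * 22 ≤? 1700)))
    where
    open ≤-Reasoning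
    -- The margin of f(4) over 2/7: 7 · 254 = 1778 against 2 · 850 = 1700, a difference of 78, and
    -- 78 · 22 = 1716 is the first multiple above 1700.
    small : 78 * n ≤ 1700
    small = +-cancelˡ-≤ (1700 * n) (78 * n) 1700 (begin
      1700 * n + 78 * n  ≡⟨ *-distribʳ-+ n 1700 78 ⟨
      1778 * n           ≡⟨ *-assoc 7 254 n ⟩
      7 * (254 * n)      ≤⟨ *-monoʳ-≤ 7 n≤a ⟩
      7 * (850 * a)      ≡⟨ *-assoc 7 850 a ⟨
      5950 * a           ≡⟨ *-assoc 850 7 a ⟩
      850 * (7 * a)      ≤⟨ *-monoʳ-≤ 850 a≤n ⟩
      850 * (2 * n + 2)  ≡⟨ *-distribˡ-+ 850 (2 * n) 2 ⟩
      850 * (2 * n) + 1700 ≡⟨ cong (_+ 1700) (sym (*-assoc 850 2 n)) ⟩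
      1700 * n + 1700    ∎)

  a<7 : ∀ {n a} → n < 22 → 7 * a ≤ 2 * n + 2 → a < 7
  a<7 {n} {a} n<22 a≤n = ≰⇒> λ 7≤a → contradiction
    (≤-trans (*-monoʳ-≤ 7 7≤a) (≤-trans a≤n (+-monoˡ-≤ 2 (*-monoʳ-≤ 2 (s≤s⁻¹ n<22)))))
    (from-yes (¬? (49 ≤? 44)))

  -- For a perfect matching: there strictness fails only if 7 a ≤ 2 n, while 7 · 254 > 2 · 850.
  even-order : ∀ {n a} → 254 * n ≤ 850 * a → 7 * a ≤ 2 * n → n ≡ 0
  even-order {n} {a} n≤a a≤n = table {n} n<22 {a} (a<7 {n} n<22 a≤n+2) n≤a a≤n
    where
    a≤n+2 = ≤-trans a≤n (m≤m+n (2 * n) 2)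
    n<22 = #-size-bound {n} {a} n≤a a≤n+2
    table : ∀ {n} → n < 22 → ∀ {a} → a < 7 → 254 * n ≤ 850 * a → 7 * a ≤ 2 * n → n ≡ 0
    table = from-yes (allUpTo? (λ n → allUpTo? (λ a →
      (254 * n ≤? 850 * a) →-dec ((7 * a ≤? 2 * n) →-dec (n ℕ.≟ 0))) 7) 22)

  -- For n = 2 h + 1 and a matching of `h` edges: there strictness fails only if 7 a ≤ 2 n + 2.
  -- Rounding `a` up excludes every order up to 21 except 3 and 13.
  odd-order : ∀ {h a} → 254 * suc (2 * h) ≤ 850 * a → 7 * a ≤ 2 * suc (2 * h) + 2 →
    h ≡ 1 ⊎ (h ≡ 6 × a ≡ 4)
  odd-order {h} {a} n≤a a≤n = table {h} (s≤s (*-cancelˡ-≤ 2 (s≤s⁻¹ (s≤s⁻¹ n<22)))) {a} (a<7 {suc (2 * h)} n<22 a≤n) n≤a a≤n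
    where
    n<22 = #-size-bound {suc (2 * h)} {a} n≤a a≤n
    table : ∀ {h} → h < 11 → ∀ {a} → a < 7 → 254 * suc (2 * h) ≤ 850 * a → 7 * a ≤ 2 * suc (2 * h) + 2 →
      h ≡ 1 ⊎ (h ≡ 6 × a ≡ 4)
    table = from-yes (allUpTo? (λ h → allUpTo? (λ a →
      (254 * suc (2 * h) ≤? 850 * a) →-dec ((7 * a ≤? 2 * suc (2 * h) + 2) →-dec
      ((h ℕ.≟ 1) ⊎-dec ((h ℕ.≟ 6) ×-dec (a ℕ.≟ 4))))) 7) 11)

  -- Components, surplus, and the induction over vertex sets

  module _ (G : Graph) where
    open Graph G using (Vertex; _~_; _~?_; ~-sym)

    Closed : VSet (n G) → VSet (n G) → Set
    Closed S C = ∀ u w → C u ≡ true → S w ≡ true → u ~ w → C w ≡ true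

    Connected : VSet (n G) → Vertex → Set
    Connected C r = C r ≡ true × (∀ u → C u ≡ true → Star (λ x y → x ~ y × C y ≡ true) r u)

    component : ∀ S r → S r ≡ true → ∃[ C ] C ⊆ᵇ S × Connected C r × Closed S C
    component S r r∈S = grow (# S) ⁅ r ⁆ (⁅⁆-⊆ r∈S) (v∈⁅v⁆ r , start) (m≤n+m _ _)
      where
      start : ∀ u → ⁅ r ⁆ u ≡ true → Star (λ x y → x ~ y × ⁅ r ⁆ y ≡ true) r u
      start u u∈ with u ≟ r
      ... | yes refl = ε
      grow : ∀ k X → X ⊆ᵇ S → Connected X r → # S ≤ # X + k →
        ∃[ C ] C ⊆ᵇ S × Connected C r × Closed S C
      grow k X X⊆S X-conn bound with any? (λ u → any? (λ w →
        (X u Bool.≟ true) ×-dec (S w Bool.≟ true) ×-dec (u ~? w) ×-dec (X w Bool.≟ false)))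
      ... | no none = X , X⊆S , X-conn , closed
        where
        closed : Closed S X
        closed u w u∈X w∈S u~w with X w in w∉X
        ... | true  = refl
        ... | false = contradiction (u , w , u∈X , w∈S , u~w , w∉X) none
      grow zero X X⊆S X-conn bound | yes (_ , w , _ , w∈S , _ , w∉X) = contradiction
        (≤-trans (≤-reflexive (sym (#-insert w X w∉X))) (≤-trans (#-mono (insert-⊆ w X⊆S w∈S)) bound))
        (<⇒≱ (s≤s (≤-reflexive (+-identityʳ (# X)))))
      grow (suc k) X X⊆S (r∈X , path) bound | yes (u , w , u∈X , w∈S , u~w , w∉X) =
        grow k (insert w X) (insert-⊆ w X⊆S w∈S) (⊆-insert w X r r∈X , path′)
          (≤-trans bound (≤-reflexive (trans (+-suc (# X) k) (cong (_+ k) (sym (#-insert w X w∉X))))))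
        where
        path↑ : ∀ x → X x ≡ true → Star (λ x y → x ~ y × insert w X y ≡ true) r x
        path↑ x x∈X = Star.map (λ (x~y , y∈X) → x~y , ⊆-insert w X _ y∈X) (path x x∈X)
        path′ : ∀ x → insert w X x ≡ true → Star (λ x y → x ~ y × insert w X y ≡ true) r x
        path′ x x∈ with insert⁻ w X x x∈
        ... | inj₁ refl = path↑ u u∈X ◅◅ ((u~w , x∈) ◅ ε)
        ... | inj₂ x∈X  = path↑ x x∈X

    -- The inequality k + 4 n ≤ 7 α + 4 β through witnesses, which can be glued; `cov` counts two
    -- vertices per edge, so it has the factor 2.
    Surplus : ℕ → VSet (n G) → Set
    Surplus k S = ∃[ I ] ∃[ m ] (Indep G I × I ⊆ᵇ S) × IsMatching G S m × k + 4 * # S ≤ 7 * # I + 2 * cov G m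

    surplus-weaken : ∀ {S} → Surplus 1 S → Surplus 0 S
    surplus-weaken (I , m , ind , M , le) = I , m , ind , M , ≤-trans (n≤1+n _) le

    module _ {S C : VSet (n G)} (C⊆S : C ⊆ᵇ S) (closed : Closed S C) where
      private R = S ∖ C

      -- No edge inside `S` leaves `C`, so the independent sets and the matchings of the two parts
      -- unite and the inequalities add.
      surplus-split : ∀ j k → Surplus j C → Surplus k (S ∖ C) → Surplus (j + k) S
      surplus-split j k (I₁ , m₁ , (ind₁ , I₁⊆C) , (invol₁ , edge₁) , le₁) (I₂ , m₂ , (ind₂ , I₂⊆R) , (invol₂ , edge₂) , le₂) =
        I , m , (ind , I⊆S) , (invol , edge) , bound
        where
        I : VSet (n G)
        I v = I₁ v ∨ I₂ v
        m : Vertex → Vertex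
        m v with C v
        ... | true  = m₁ v
        ... | false = m₂ v
        m-in : ∀ {v} → C v ≡ true → m v ≡ m₁ v
        m-in {v} v∈C with C v
        ... | true = refl
        m-out : ∀ {v} → C v ≡ false → m v ≡ m₂ v
        m-out {v} v∉C with C v
        ... | false = refl
        R⇒∉C : ∀ {v} → R v ≡ true → C v ≡ false
        R⇒∉C {v} v∈R = proj₂ (∖⁻ S C v v∈R)
        I⁻ : ∀ v → I v ≡ true → I₁ v ≡ true ⊎ I₂ v ≡ true
        I⁻ v v∈ with I₁ v
        ... | true  = inj₁ refl
        ... | false = inj₂ v∈
        I⊆S : I ⊆ᵇ S
        I⊆S v v∈ with I⁻ v v∈
        ... | inj₁ v∈₁ = C⊆S v (I₁⊆C v v∈₁)
        ... | inj₂ v∈₂ = ∖-⊆ S C v (I₂⊆R v v∈₂)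
        no-cross : ∀ {u v} → C u ≡ true → R v ≡ true → ¬ u ~ v
        no-cross {u} {v} u∈C v∈R u~v = true≢false (closed u v u∈C (∖-⊆ S C v v∈R) u~v) (R⇒∉C v∈R)
        ind : Indep G I
        ind u v u∈ v∈ u~v with I⁻ u u∈ | I⁻ v v∈
        ... | inj₁ u∈₁ | inj₁ v∈₁ = ind₁ u v u∈₁ v∈₁ u~v
        ... | inj₁ u∈₁ | inj₂ v∈₂ = no-cross (I₁⊆C u u∈₁) (I₂⊆R v v∈₂) u~v
        ... | inj₂ u∈₂ | inj₁ v∈₁ = no-cross (I₁⊆C v v∈₁) (I₂⊆R u u∈₂) (~-sym u~v)
        ... | inj₂ u∈₂ | inj₂ v∈₂ = ind₂ u v u∈₂ v∈₂ u~v
        invol : ∀ v → m (m v) ≡ v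
        invol v with C v in v∈C
        ... | true with m₁ v ≟ v
        ...   | yes eq = trans (cong m eq) (trans (m-in v∈C) eq)
        ...   | no ne  = trans (m-in (proj₁ (edge₁ (m₁ v) (λ eq → ne (trans (sym eq) (invol₁ v)))))) (invol₁ v)
        invol v | false with m₂ v ≟ v
        ...   | yes eq = trans (cong m eq) (trans (m-out v∈C) eq)
        ...   | no ne  = trans (m-out (R⇒∉C (proj₁ (edge₂ (m₂ v) (λ eq → ne (trans (sym eq) (invol₂ v))))))) (invol₂ v)
        edge : ∀ v → m v ≢ v → S v ≡ true × v ~ m v
        edge v ne with C v
        ... | true  = C⊆S v (proj₁ (edge₁ v ne)) , proj₂ (edge₁ v ne)
        ... | false = ∖-⊆ S C v (proj₁ (edge₂ v ne)) , proj₂ (edge₂ v ne)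
        outside₁ : ∀ {v} → C v ≡ false → m₁ v ≡ v
        outside₁ {v} v∉C = decidable-stable (m₁ v ≟ v) (λ ne → true≢false (proj₁ (edge₁ v ne)) v∉C)
        outside₂ : ∀ {v} → C v ≡ true → m₂ v ≡ v
        outside₂ {v} v∈C = decidable-stable (m₂ v ≟ v) (λ ne → true≢false v∈C (R⇒∉C (proj₁ (edge₂ v ne))))
        cov-m : cov G m ≡ cov G m₁ + cov G m₂
        cov-m = trans (sum-cong lemma) (sum-+ _ _)
          where
          lemma : ∀ v → ι (not (does (m v ≟ v))) ≡ ι (not (does (m₁ v ≟ v))) + ι (not (does (m₂ v ≟ v)))
          lemma v with C v in v∈C
          ... | true  rewrite dec-true (m₂ v ≟ v) (outside₂ v∈C) = sym (+-identityʳ _)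
          ... | false rewrite dec-true (m₁ v ≟ v) (outside₁ v∈C) = refl
        #I : # I ≡ # I₁ + # I₂
        #I = trans (sum-cong lemma) (sum-+ _ _)
          where
          lemma : ∀ v → ι (I v) ≡ ι (I₁ v) + ι (I₂ v)
          lemma v with I₁ v in v∈₁ | I₂ v in v∈₂
          ... | true  | true  = contradiction (R⇒∉C (I₂⊆R v v∈₂)) (true≢false (I₁⊆C v v∈₁))
          ... | true  | false = refl
          ... | false | _     = refl
        bound : j + k + 4 * # S ≤ 7 * # I + 2 * cov G m
        bound rewrite cov-m | #I | #-∖ S C C⊆S = begin
          j + k + 4 * (# C + # R)                                      ≡⟨ left j k (# C) (# R) ⟩
          (j + 4 * # C) + (k + 4 * # R)                                ≤⟨ +-mono-≤ le₁ le₂ ⟩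
          (7 * # I₁ + 2 * cov G m₁) + (7 * # I₂ + 2 * cov G m₂)        ≡⟨ right (# I₁) (# I₂) (cov G m₁) (cov G m₂) ⟩
          7 * (# I₁ + # I₂) + 2 * (cov G m₁ + cov G m₂)                ∎
          where
          open ≤-Reasoning
          left : ∀ j k x y → j + k + 4 * (x + y) ≡ (j + 4 * x) + (k + 4 * y)
          left = solve-∀
          right : ∀ x y z t → (7 * x + 2 * z) + (7 * y + 2 * t) ≡ 7 * (x + y) + 2 * (z + t)
          right = solve-∀

    -- From these two conditions the inequality itself forces α = 4 and β = 6.
    Tight : VSet (n G) → Set
    Tight S = # S ≡ 13 × (∀ I → Indep G I → I ⊆ᵇ S → # I ≤ 4)

    module _ (tf : TriangleFree G) (Δ≤4 : MaxDeg≤4 G) where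
      open Shearer G tf Δ≤4

      shearer-uniform : ∀ S D → D ≤ 4 → (∀ v → S v ≡ true → deg G S v ≤ D) →
        ∃[ I ] (Indep G I × I ⊆ᵇ S) × weight D * # S ≤ 850 * # I
      shearer-uniform S D D≤4 deg≤D with shearer S
      ... | I , ind , I⊆S , bound = I , (ind , I⊆S) , (begin
        weight D * # S                                ≡⟨ sum-*ˡ (weight D) _ ⟨
        sum (λ v → weight D * ι (S v))                ≤⟨ sum-mono pointwise ⟩
        sum (λ v → ι (S v) * weight (deg G S v))      ≤⟨ bound ⟩
        W * # I                                  ≡⟨ W*≡850* (# I) ⟩
        850 * # I                                ∎)
        where
        open ≤-Reasoning
        pointwise : ∀ v → weight D * ι (S v) ≤ ι (S v) * weight (deg G S v)
        pointwise v with S v in v∈S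
        ... | false = ≤-reflexive (*-zeroʳ (weight D))
        ... | true  = ≤-trans (≤-reflexive (*-identityʳ (weight D)))
          (≤-trans (weight-antitone (deg≤D v v∈S) D≤4) (≤-reflexive (sym (*-identityˡ _))))

      -- A vertex of degree at most 3 would leave at least 9 vertices without an
      -- independent set of size 4, against R(3,4) = 9.
      tight⇒regular : ∀ {S} → Tight S → ∀ u → S u ≡ true → 4 ≤ deg G S u
      tight⇒regular {S} (#S≡13 , α≤4) u u∈S = ≮⇒≥ λ deg<4 → absurd (s≤s⁻¹ deg<4)
        where
        T = _∖N[_] G S u
        α≤3 : ∀ J → Indep G J → J ⊆ᵇ T → # J ≤ 3
        α≤3 J ind J⊆T = s≤s⁻¹ (subst (_≤ 4) (#-insert u J u∉J)
          (α≤4 (insert u J) (insert-indep G ind (λ w w∈J → proj₂ (proj₂ (∖N⁻ G {S} {u} {w} (J⊆T w w∈J)))))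
            (insert-⊆ u (λ w w∈J → ∖N-⊆ G {S} {u} w (J⊆T w w∈J)) u∈S)))
          where
          u∉J : J u ≡ false
          u∉J with J u in u∈J
          ... | false = refl
          ... | true  = contradiction refl (proj₁ (proj₂ (∖N⁻ G {S} {u} {u} (J⊆T u u∈J))))
        -- Without triangles neighbourhoods are independent, so the bound 3 on independent sets in
        -- `T` also bounds its degrees.
        deg≤3 : ∀ w → T w ≡ true → deg G T w ≤ 3
        deg≤3 w _ = subst (_≤ 3) (sum-cong size) (α≤3 N N-ind (λ x x∈N → proj₁ (N⁻ x x∈N)))
          where
          N : VSet (n G)
          N x = T x ∧ does (w ~? x)
          N⁻ : ∀ x → N x ≡ true → T x ≡ true × w ~ x
          N⁻ x x∈N with T x | w ~? x
          ... | true | yes w~x = refl , w~x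
          N-ind : Indep G N
          N-ind x y x∈N y∈N x~y = tf w x y (proj₂ (N⁻ x x∈N) , x~y , proj₂ (N⁻ y y∈N))
          size : ∀ x → ι (N x) ≡ ι (T x) * adj G w x
          size x with T x
          ... | true  = sym (*-identityˡ _)
          ... | false = refl
        absurd : deg G S u ≤ 3 → ⊥
        -- The part of R(3,4) = 9 that is needed comes from f(3) = 289/850: 289 · 9 = 2601 exceeds
        -- 850 · 3 = 2550.
        absurd deg≤ with shearer-uniform T 3 (s≤s (s≤s (s≤s z≤n))) deg≤3
        ... | J , (ind , J⊆T) , bound = contradiction
          (≤-trans (*-monoʳ-≤ 289 9≤#T) (≤-trans bound (*-monoʳ-≤ 850 (α≤3 J ind J⊆T))))
          (from-yes (¬? (289 * 9 ≤? 850 * 3)))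
          where
          9≤#T : 9 ≤ # T
          9≤#T = +-cancelˡ-≤ 4 9 (# T) (≤-trans (≤-reflexive (trans (sym #S≡13) (#-∖N G S u u∈S)))
            (s≤s (+-monoˡ-≤ (# T) deg≤)))

      -- `u` already has four neighbours inside `C`, and `v` would be a fifth.
      no-tight-neighbour : ∀ {C} → Tight C → ∀ {u v} → C u ≡ true → C v ≡ false → ¬ u ~ v
      no-tight-neighbour {C} tight {u} {v} u∈C v∉C u~v =
        contradiction (≤-trans (+-monoˡ-≤ 1 (tight⇒regular tight u u∈C)) degree≥) (<⇒≱ (s≤s (Δ≤4 u)))
        where
        degree≥ : deg G C u + 1 ≤ sum (adj G u)
        degree≥ = subst (_≤ sum (adj G u)) (trans (sum-+ _ _) (cong (deg G C u +_) (sum-δ v))) (sum-mono lemma)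
          where
          lemma : ∀ w → ι (C w) * adj G u w + δ v w ≤ adj G u w
          lemma w with w ≟ v
          ... | yes refl rewrite v∉C = ≤-reflexive (sym (adj≡1 G u~v))
          ... | no _ with C w
          ...   | true  = ≤-reflexive (trans (+-identityʳ _) (*-identityˡ _))
          ...   | false = z≤n

      Dichotomy : VSet (n G) → Set
      Dichotomy S = Surplus 1 S ⊎ (Tight S × Surplus 0 S)

      dichotomy⇒surplus : ∀ {S} → Dichotomy S → Surplus 0 S
      dichotomy⇒surplus (inj₁ strict)  = surplus-weaken strict
      dichotomy⇒surplus (inj₂ (_ , s)) = s

      larger-indep? : ∀ S → Dec (∃[ J ] (Indep G J × J ⊆ᵇ S) × 5 ≤ # J)
      larger-indep? S = any-set?
        (λ {A} {B} A≗B ((ind , A⊆S) , 5≤) →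
          ((λ u v u∈ v∈ → ind u v (trans (A≗B u) u∈) (trans (A≗B v) v∈)) , λ v v∈ → A⊆S v (trans (A≗B v) v∈)) ,
          subst (5 ≤_) (sum-cong (λ v → cong ι (A≗B v))) 5≤)
        (λ A → (all? (λ u → all? (λ v → (A u Bool.≟ true) →-dec ((A v Bool.≟ true) →-dec ¬? (u ~? v))))
          ×-dec all? (λ v → (A v Bool.≟ true) →-dec (S v Bool.≟ true))) ×-dec (5 ≤? # A))

      near-perfect : ∀ {S M r} → S r ≡ true → IsMatching G S M → # S ≤ cov G M + 1 → Dichotomy S
      near-perfect {S} {M} {r} r∈S isM #S≤ with shearer-uniform S 4 ≤-refl (λ v _ → deg≤4 S v)
      ... | I , indI , bound with 1 + 4 * # S ≤? 7 * # I + 2 * cov G M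
      ... | yes strict = inj₁ (I , M , indI , isM , strict)
      ... | no not-strict with m≤n⇒m<n∨m≡n (cov≤#S G isM)
      ...   | inj₂ c≡#S = contradiction (even-order {# S} {# I} bound small)
                            (λ #S≡0 → contradiction (subst (1 ≤_) #S≡0 (member⇒#>0 S r r∈S)) λ ())
        where
        open ≤-Reasoning
        small : 7 * # I ≤ 2 * # S
        small = +-cancelʳ-≤ (2 * # S) (7 * # I) (2 * # S) (begin
          7 * # I + 2 * # S       ≡⟨ cong (λ c → 7 * # I + 2 * c) (sym c≡#S) ⟩
          7 * # I + 2 * cov G M   ≤⟨ s≤s⁻¹ (≰⇒> not-strict) ⟩
          4 * # S                 ≡⟨ *-distribʳ-+ (# S) 2 2 ⟩
          2 * # S + 2 * # S       ∎)
      ...   | inj₁ c<#S = odd (edgeCount G M) (cov-even G isM)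
        where
        #S≡ : # S ≡ suc (cov G M)
        #S≡ = ≤-antisym (≤-trans #S≤ (≤-reflexive (+-comm _ 1))) c<#S
        odd : ∀ h → cov G M ≡ 2 * h → Dichotomy S
        odd h c≡2h = split (odd-order {h} {# I} (subst (λ s → 254 * s ≤ 850 * # I) #S≡1+2h bound) small)
          where
          open ≤-Reasoning
          #S≡1+2h : # S ≡ suc (2 * h)
          #S≡1+2h = trans #S≡ (cong suc c≡2h)
          small : 7 * # I ≤ 2 * suc (2 * h) + 2
          small = +-cancelʳ-≤ (2 * (2 * h)) (7 * # I) (2 * suc (2 * h) + 2) (begin
            7 * # I + 2 * (2 * h)              ≡⟨ cong (λ c → 7 * # I + 2 * c) c≡2h ⟨
            7 * # I + 2 * cov G M              ≤⟨ s≤s⁻¹ (≰⇒> not-strict) ⟩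
            4 * # S                            ≡⟨ cong (4 *_) #S≡1+2h ⟩
            4 * suc (2 * h)                    ≡⟨ rearrange (2 * h) ⟩
            2 * suc (2 * h) + 2 + 2 * (2 * h)  ∎)
            where
            rearrange : ∀ x → 4 * suc x ≡ 2 * suc x + 2 + 2 * x
            rearrange = solve-∀
          split : h ≡ 1 ⊎ (h ≡ 6 × # I ≡ 4) → Dichotomy S
          -- At order 3 the constant f(4) yields only one vertex. Degrees are at most 2 there, and
          -- f(2) yields two: 340 · 3 > 850.
          split (inj₁ refl) = inj₁ (small-order (shearer-uniform S 2 (s≤s (s≤s z≤n)) deg≤2))
            where
            deg≤2 : ∀ v → S v ≡ true → deg G S v ≤ 2
            deg≤2 v v∈S = s≤s⁻¹ (≤-trans (s≤s (m≤m+n (deg G S v) _))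
              (≤-reflexive (trans (sym (#-∖N G S v v∈S)) #S≡1+2h)))
            small-order : ∃[ J ] (Indep G J × J ⊆ᵇ S) × weight 2 * # S ≤ 850 * # J → Surplus 1 S
            small-order (J , indJ , boundJ) = J , M , indJ , isM , (begin
              1 + 4 * # S               ≡⟨ cong (λ s → 1 + 4 * s) #S≡1+2h ⟩
              13                        ≤⟨ from-yes (13 ≤? 18) ⟩
              7 * 2 + 2 * 2             ≤⟨ +-monoˡ-≤ (2 * 2) (*-monoʳ-≤ 7 2≤#J) ⟩
              7 * # J + 2 * 2           ≡⟨ cong (λ c → 7 * # J + 2 * c) c≡2h ⟨
              7 * # J + 2 * cov G M     ∎)
              where
              2≤#J : 2 ≤ # J
              2≤#J = ≰⇒> λ #J≤1 → contradiction
                (≤-trans (≤-reflexive (cong (340 *_) (sym #S≡1+2h))) (≤-trans boundJ (*-monoʳ-≤ 850 #J≤1)))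
                (from-yes (¬? (340 * 3 ≤? 850 * 1)))
          -- `I` has size 4 but need not be maximum: a fifth vertex makes the inequality strict, and
          -- its absence is what `Tight` asks for.
          split (inj₂ (refl , #I≡4)) with larger-indep? S
          ... | yes (J , indJ , 5≤#J) = inj₁ (J , M , indJ , isM , (begin
              1 + 4 * # S               ≡⟨ cong (λ s → 1 + 4 * s) #S≡1+2h ⟩
              53                        ≤⟨ from-yes (53 ≤? 59) ⟩
              7 * 5 + 2 * 12            ≤⟨ +-monoˡ-≤ (2 * 12) (*-monoʳ-≤ 7 5≤#J) ⟩
              7 * # J + 2 * 12          ≡⟨ cong (λ c → 7 * # J + 2 * c) c≡2h ⟨
              7 * # J + 2 * cov G M     ∎))
          ... | no none = inj₂ ((#S≡1+2h , λ J ind J⊆S → s≤s⁻¹ (≰⇒> λ 5≤ → none (J , (ind , J⊆S) , 5≤))) ,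
              I , M , indI , isM , ≤-reflexive (trans (cong (4 *_) #S≡1+2h)
                (sym (cong₂ (λ i c → 7 * i + 2 * c) #I≡4 c≡2h))))

      surplus-empty : ∀ {S} → # S ≤ 0 → Surplus 0 S
      surplus-empty {S} #S≤0 = (λ _ → false) , (λ v → v) , ((λ _ _ ()) , (λ _ ())) , id-isMatching G {S} ,
        ≤-trans (*-monoʳ-≤ 4 #S≤0) z≤n

      -- A matching that avoids the essential vertex `v` is not maximum, and by parity it covers at
      -- least two vertices fewer. This 2 · 2 pays for the 4 that `v` adds on the left.
      surplus-delete : ∀ {S v c} → S v ≡ true →
        (∃[ M ] IsMatching G S M × cov G M ≡ c) → (∀ m → IsMatching G S m → cov G m ≤ c) →
        ¬ (∃[ m ] (IsMatching G S m × cov G m ≡ c) × m v ≡ v) →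
        Surplus 1 (S ∖ ⁅ v ⁆) → Surplus 1 S
      surplus-delete {S} {v} {c} v∈S (M , isM , covM) c-max essential (I , m , (ind , I⊆T) , ism , bound) =
        I , M , (ind , λ u u∈I → T⊆S u (I⊆T u u∈I)) , isM , (begin
          1 + 4 * # S                   ≡⟨ cong (λ s → 1 + 4 * s) #S≡ ⟩
          1 + 4 * suc (# T)             ≡⟨ rearrange (# T) ⟩
          (1 + 4 * # T) + 4             ≤⟨ +-monoˡ-≤ 4 bound ⟩
          7 * # I + 2 * cov G m + 4     ≡⟨ rearrange₂ (7 * # I) (cov G m) ⟩
          7 * # I + 2 * (cov G m + 2)   ≤⟨ +-monoʳ-≤ (7 * # I) (*-monoʳ-≤ 2 cov+2) ⟩
          7 * # I + 2 * cov G M         ∎)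
        where
        open ≤-Reasoning
        T = S ∖ ⁅ v ⁆
        T⊆S = ∖-⊆ S ⁅ v ⁆
        rearrange : ∀ x → 1 + 4 * suc x ≡ (1 + 4 * x) + 4
        rearrange = solve-∀
        rearrange₂ : ∀ x y → x + 2 * y + 4 ≡ x + 2 * (y + 2)
        rearrange₂ = solve-∀
        #S≡ : # S ≡ suc (# T)
        #S≡ = trans (#-∖ S ⁅ v ⁆ (⁅⁆-⊆ v∈S)) (cong (_+ # T) (sum-δ v))
        mv≡v : m v ≡ v
        mv≡v = decidable-stable (m v ≟ v) λ mv≢v →
          true≢false (v∈⁅v⁆ v) (proj₂ (∖⁻ S ⁅ v ⁆ v (proj₁ (proj₂ ism v mv≢v))))
        ism′ : IsMatching G S m
        ism′ = isMatching-mono G T⊆S ism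
        cov+2 : cov G m + 2 ≤ cov G M
        cov+2 with cov-even G isM | cov-even G ism | ≤∧≢⇒< (c-max m ism′) (λ eq → essential (m , (ism′ , eq) , mv≡v))
        ... | M≡2h | m≡2k | m<c = step (edgeCount G M) (edgeCount G m) M≡2h m≡2k (subst (cov G m <_) (sym covM) m<c)
          where
          step : ∀ {x y} h k → x ≡ 2 * h → y ≡ 2 * k → y < x → y + 2 ≤ x
          step h k refl refl y<x = ≤-trans (≤-reflexive (trans (+-comm (2 * k) 2) (sym (*-suc 2 k))))
            (*-monoʳ-≤ 2 (*-cancelˡ-< 2 k h y<x))

      SurplusUpTo DichotomyUpTo : ℕ → Set
      SurplusUpTo k   = ∀ S → # S ≤ k → Surplus 0 S
      DichotomyUpTo k = ∀ S r → # S ≤ k → Connected S r → Dichotomy S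

      dichotomy-step : ∀ k → SurplusUpTo k → DichotomyUpTo k → DichotomyUpTo (suc k)
      dichotomy-step k surplus dichotomy S r #S≤ (r∈S , path) with maximum-matching G S
      ... | M , isM , M-max
        with any? (λ v → (S v Bool.≟ true) ×-dec ¬? (missed? G S (cov G M) v))
      ...   | no none = near-perfect r∈S isM
        (Gallai.gallai G S (cov G M) M-max path r∈S
          (λ t t∈S → decidable-stable (missed? G S (cov G M) t) (λ ¬missed → none (t , t∈S , ¬missed)))
          (isM , refl))
      -- The component of the partner `M v` is chosen because `v` is adjacent to it and lies
      -- outside.
      ...   | yes (v , v∈S , essential) with component (S ∖ ⁅ v ⁆) (M v)
              (∖⁺ S ⁅ v ⁆ (M v) (proj₁ (proj₂ isM (M v) Mv-covered)) (dec-false (M v ≟ v) Mv≢v))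
        where
        Mv≢v : M v ≢ v
        Mv≢v Mv≡v = essential (M , (isM , refl) , Mv≡v)
        Mv-covered : M (M v) ≢ M v
        Mv-covered eq = Mv≢v (trans (sym eq) (proj₁ isM v))
      ...     | C , C⊆T , conn , closed
        with dichotomy C (M v) (≤-trans (#-mono C⊆T) (#-∖-≤ S ⁅ v ⁆ v (⁅⁆-⊆ v∈S) (v∈⁅v⁆ v) #S≤)) conn
      -- One strict component suffices; the rest may be disconnected and needs only surplus 0.
      ...       | inj₁ strict = inj₁ (surplus-delete v∈S (M , isM , refl) M-max essential
          (surplus-split C⊆T closed 1 0 strict
            (surplus (T ∖ C) (≤-trans (#-mono (∖-⊆ T C)) (#-∖-≤ S ⁅ v ⁆ v (⁅⁆-⊆ v∈S) (v∈⁅v⁆ v) #S≤)))))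
        where T = S ∖ ⁅ v ⁆
      ...       | inj₂ (tight , _) = contradiction (~-sym (proj₂ (proj₂ isM v (λ eq → essential (M , (isM , refl) , eq)))))
          (no-tight-neighbour tight (proj₁ conn) v∉C)
        where
        v∉C : C v ≡ false
        v∉C with C v in v∈C
        ... | false = refl
        ... | true  = contradiction (proj₂ (∖⁻ S ⁅ v ⁆ v (C⊆T v v∈C))) (true≢false (v∈⁅v⁆ v))

      surplus-step : ∀ k → SurplusUpTo k → DichotomyUpTo (suc k) → SurplusUpTo (suc k)
      surplus-step k surplus dichotomy S #S≤ with any? (λ v → S v Bool.≟ true)
      ... | no empty = surplus-empty (≮⇒≥ λ #S>0 → empty (#>0⇒member S #S>0))
      ... | yes (r , r∈S) with component S r r∈S
      ...   | C , C⊆S , conn , closed = surplus-split C⊆S closed 0 0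
        (dichotomy⇒surplus (dichotomy C r (≤-trans (#-mono C⊆S) #S≤) conn))
        (surplus (S ∖ C) (#-∖-≤ S C r C⊆S (proj₁ conn) #S≤))

      -- The dichotomy at `suc k` uses both statements at `k`. The surplus at `suc k` also uses the
      -- dichotomy at `suc k`, since a component of `S` may be all of `S`.
      surplus∧dichotomy : ∀ k → SurplusUpTo k × DichotomyUpTo k
      surplus∧dichotomy zero =
        (λ S → surplus-empty) ,
        (λ S r #S≤0 (r∈S , _) → contradiction (≤-trans (member⇒#>0 S r r∈S) #S≤0) λ ())
      surplus∧dichotomy (suc k) with surplus∧dichotomy k
      ... | surplus , dichotomy = surplus-step k surplus dichotomy′ , dichotomy′
        where dichotomy′ = dichotomy-step k surplus dichotomy

      surplus : ∀ S → Surplus 0 S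
      surplus S = proj₁ (surplus∧dichotomy (# S)) S ≤-refl

      dichotomy : ∀ S r → Connected S r → Dichotomy S
      dichotomy S r = proj₂ (surplus∧dichotomy (# S)) S r ≤-refl

  -- The invariants α and β, and induced subgraphs

  maxSize-upper : ∀ {m} {P : U.Pred (Subset m) 0ℓ} (P? : U.Decidable P) S → P S → ∣ S ∣ ≤ maxSize P?
  maxSize-upper {m} P? S PS = All.lookup (xs≤max 0 _)
    (List.∈-map⁺ ∣_∣ (List.∈-filter⁺ P? (complete S) PS))
    where
    complete : ∀ {m} (S : Subset m) → S List.∈ subsets m
    complete []            = Any.here refl
    complete (true ∷ S)    = List.∈-++⁺ˡ (List.∈-map⁺ _ (complete S))
    complete (false ∷ S)   = List.∈-++⁺ʳ _ (List.∈-map⁺ _ (complete S))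

  maxSize-attained : ∀ {m} {P : U.Pred (Subset m) 0ℓ} (P? : U.Decidable P) S₀ → P S₀ →
    ∃[ S ] P S × ∣ S ∣ ≡ maxSize P?
  maxSize-attained {m} P? S₀ PS₀
    with argmax-sel (λ x → x) 0 (List.map ∣_∣ (filter P? (subsets m)))
  -- If the maximum is the default 0, then `S₀` attains it.
  ... | inj₁ max≡0 = S₀ , PS₀ , ≤-antisym (maxSize-upper P? S₀ PS₀) (≤-trans (≤-reflexive max≡0) z≤n)
  ... | inj₂ max∈ with List.∈-map⁻ ∣_∣ max∈
  ...   | S , S∈ , max≡ = S , proj₂ (List.∈-filter⁻ P? {xs = subsets m} S∈) , sym max≡

  ⟦_⟧ : ∀ {m} → Subset m → VSet m
  ⟦ S ⟧ = Vec.lookup S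

  ∈⇒⟦⟧ : ∀ {m} {S : Subset m} {v} → v ∈ S → ⟦ S ⟧ v ≡ true
  ∈⇒⟦⟧ = []=⇒lookup

  ⟦⟧⇒∈ : ∀ {m} (S : Subset m) v → ⟦ S ⟧ v ≡ true → v ∈ S
  ⟦⟧⇒∈ S v = lookup⇒[]= v S

  does-∈? : ∀ {m} (S : Subset m) v → does (v ∈? S) ≡ ⟦ S ⟧ v
  does-∈? S v with v ∈? S | ⟦ S ⟧ v in eq
  ... | yes _   | true  = refl
  ... | yes v∈S | false = contradiction eq (true≢false (∈⇒⟦⟧ v∈S))
  ... | no v∉S  | true  = contradiction (⟦⟧⇒∈ S v eq) v∉S
  ... | no _    | false = refl

  ∣∣≡# : ∀ {m} (S : Subset m) → ∣ S ∣ ≡ # ⟦ S ⟧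
  ∣∣≡# []          = sym (sum-≡0 λ ())
  ∣∣≡# (true ∷ S)  = trans (cong suc (∣∣≡# S)) (sym (sum-suc _))
  ∣∣≡# (false ∷ S) = trans (∣∣≡# S) (sym (sum-suc _))

  ∣tabulate∣ : ∀ {m} (A : VSet m) → ∣ Vec.tabulate A ∣ ≡ # A
  ∣tabulate∣ A = trans (∣∣≡# (Vec.tabulate A)) (sum-cong (λ v → cong ι (lookup∘tabulate A v)))

  module _ {A : Set} where

    opaque

      -- A sum over positions, because edges and the vertices of an induced subgraph are positions
      -- in filtered lists.
      listSum : List A → (A → ℕ) → ℕ
      listSum xs f = sum (λ i → f (List.lookup xs i))

      listSum≡sum : ∀ xs f → listSum xs f ≡ sum (λ i → f (List.lookup xs i))
      listSum≡sum xs f = refl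

      listSum-∷ : ∀ x xs f → listSum (x List.∷ xs) f ≡ f x + listSum xs f
      listSum-∷ x xs f = sum-suc _

      listSum-++ : ∀ xs ys f → listSum (xs List.++ ys) f ≡ listSum xs f + listSum ys f
      listSum-++ List.[] ys f = sym (cong (_+ listSum ys f) (sum-zero _))
      listSum-++ (x List.∷ xs) ys f = trans (listSum-∷ x (xs List.++ ys) f)
        (trans (cong (f x +_) (listSum-++ xs ys f)) (trans (sym (+-assoc (f x) _ _))
          (cong (_+ listSum ys f) (sym (listSum-∷ x xs f)))))

      listSum-filter : ∀ {P : A → Set} (P? : ∀ x → Dec (P x)) xs f →
        listSum (filter P? xs) f ≡ listSum xs (λ x → ι (does (P? x)) * f x)
      listSum-filter P? List.[] f = trans (sum-zero _) (sym (sum-zero _))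
      listSum-filter P? (x List.∷ xs) f with P? x
      ... | yes p = trans (listSum-∷ x _ f) (trans
        (cong₂ _+_ (sym (trans (cong (λ b → ι b * f x) (dec-true (P? x) p)) (*-identityˡ (f x))))
          (listSum-filter P? xs f)) (sym (listSum-∷ x xs _)))
      ... | no ¬p = trans (listSum-filter P? xs f) (sym (trans (listSum-∷ x xs _)
        (cong (λ b → ι b * f x + listSum xs (λ x → ι (does (P? x)) * f x)) (dec-false (P? x) ¬p))))

      listSum-tabulate : ∀ {m} (h : Fin m → A) f → listSum (List.tabulate h) f ≡ sum (λ i → f (h i))
      listSum-tabulate {zero} h f = trans (sum-zero _) (sym (sum-zero _))
      listSum-tabulate {suc m} h f = trans (listSum-∷ (h zero) _ f)
        (trans (cong (f (h zero) +_) (listSum-tabulate (λ i → h (suc i)) f)) (sym (sum-suc _)))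

    length≡listSum : ∀ (xs : List A) → length xs ≡ listSum xs (λ _ → 1)
    length≡listSum xs = sym (trans (listSum≡sum xs _) (trans (sum-const (length xs) 1) (*-identityʳ _)))

    lookup-injective : ∀ {xs : List A} → Unique xs → ∀ i j → List.lookup xs i ≡ List.lookup xs j → i ≡ j
    lookup-injective (_ ∷ _) zero zero eq = refl
    lookup-injective (x∉ ∷ _) zero (suc j) eq = contradiction eq (All.lookup x∉ (List.∈-lookup j))
    lookup-injective (x∉ ∷ _) (suc i) zero eq = contradiction (sym eq) (All.lookup x∉ (List.∈-lookup i))
    lookup-injective (_ ∷ xs!) (suc i) (suc j) eq = cong suc (lookup-injective xs! i j eq)

  opaque
    unfolding listSum

    listSum-map : ∀ {A B : Set} (h : A → B) xs f → listSum (List.map h xs) f ≡ listSum xs (λ x → f (h x))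
    listSum-map h List.[] f = trans (sum-zero _) (sym (sum-zero _))
    listSum-map h (x List.∷ xs) f = trans (listSum-∷ (h x) _ f)
      (trans (cong (f (h x) +_) (listSum-map h xs f)) (sym (listSum-∷ x xs _)))

    listSum-cartesianProduct : ∀ {A B : Set} (xs : List A) (ys : List B) f →
      listSum (cartesianProduct xs ys) f ≡ listSum xs (λ x → listSum ys (λ y → f (x , y)))
    listSum-cartesianProduct List.[] ys f = trans (sum-zero _) (sym (sum-zero _))
    listSum-cartesianProduct (x List.∷ xs) ys f = trans (listSum-++ (List.map (x ,_) ys) _ f)
      (trans (cong₂ _+_ (listSum-map (x ,_) ys f) (listSum-cartesianProduct xs ys f)) (sym (listSum-∷ x xs _)))

  full : ∀ {m} → VSet m
  full _ = true

  #-full : ∀ m → # full {m} ≡ m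
  #-full m = trans (sum-const m 1) (*-identityʳ m)

  -- α and β through Boolean vertex sets and involutions

  module _ (G : Graph) where
    open Graph G using (Vertex; _~_; _~?_; ~-sym; degree; independent?;
      edges; Edge; Matching; matching?)

    degree≡sum : ∀ v → degree v ≡ sum (adj G v)
    degree≡sum v = trans (length≡listSum _) (trans (listSum-filter (v ~?_) (allFin (n G)) _)
      (trans (listSum-tabulate (λ i → i) _) (sum-cong (λ u → *-identityʳ _))))

    Δ≤⇒MaxDeg≤4 : Δ G ≤ 4 → MaxDeg≤4 G
    Δ≤⇒MaxDeg≤4 Δ≤4 v = subst (_≤ 4) (degree≡sum v)
      (≤-trans (All.lookup (xs≤max 0 _) (List.∈-map⁺ degree (List.∈-allFin v))) Δ≤4)

    indep≤α : ∀ I → Indep G I → # I ≤ α G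
    indep≤α I ind = subst (_≤ α G) (∣tabulate∣ I) (maxSize-upper independent? (Vec.tabulate I) λ u v u∈ v∈ →
      ind u v (trans (sym (lookup∘tabulate I u)) (∈⇒⟦⟧ u∈)) (trans (sym (lookup∘tabulate I v)) (∈⇒⟦⟧ v∈)))

    α-attained : ∃[ I ] Indep G I × # I ≡ α G
    α-attained with maxSize-attained independent? (Vec.tabulate (λ _ → false))
      (λ u v u∈ _ _ → true≢false (∈⇒⟦⟧ u∈) (lookup∘tabulate (λ _ → false) u))
    ... | S , ind , size = ⟦ S ⟧ , (λ u v u∈ v∈ → ind u v (⟦⟧⇒∈ S u u∈) (⟦⟧⇒∈ S v v∈)) , trans (sym (∣∣≡# S)) size

    private
      src tgt : Edge → Vertex
      src e = proj₁ (List.lookup edges e)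
      tgt e = proj₂ (List.lookup edges e)

    edge-prop : ∀ e → src e Fin.< tgt e × src e ~ tgt e
    edge-prop e = proj₂ (List.∈-filter⁻ (λ (u , v) → (u Fin.<? v) ×-dec (u ~? v))
      {xs = cartesianProduct (allFin (n G)) (allFin (n G))} (List.∈-lookup {xs = edges} e))

    edge-unique : ∀ e f → src e ≡ src f → tgt e ≡ tgt f → e ≡ f
    edge-unique e f s t = lookup-injective (Unique.filter⁺ _
      (Unique.cartesianProduct⁺ (Unique.allFin⁺ (n G)) (Unique.allFin⁺ (n G)))) e f (cong₂ _,_ s t)

    edgesOf : (Vertex → Vertex) → VSet (length edges)
    edgesOf m e = does (m (src e) ≟ tgt e)

    #-edgesOf : ∀ {m} → IsMatching G full m → # (edgesOf m) ≡ edgeCount G m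
    #-edgesOf {m} (_ , edge) = begin
      # (edgesOf m)                                                          ≡⟨ listSum≡sum edges _ ⟨
      listSum edges (λ (u , v) → ι (does (m u ≟ v)))                         ≡⟨ listSum-filter _ _ _ ⟩
      listSum (cartesianProduct (allFin (n G)) (allFin (n G))) incidence        ≡⟨ listSum-cartesianProduct (allFin (n G)) _ _ ⟩
      listSum (allFin (n G)) (λ u → listSum (allFin (n G)) (λ v → incidence (u , v))) ≡⟨ listSum-tabulate _ _ ⟩
      sum (λ u → listSum (allFin (n G)) (λ v → incidence (u , v)))
        ≡⟨ sum-cong (λ u → trans (listSum-tabulate _ _) (trans (sum-cong (simplify u)) (sum-δ-* (m u) _))) ⟩
      edgeCount G m ∎
      where
      open ≡-Reasoning
      incidence : Vertex × Vertex → ℕ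
      incidence (u , v) = ι (does ((u Fin.<? v) ×-dec (u ~? v))) * ι (does (m u ≟ v))
      simplify : ∀ u v → incidence (u , v) ≡ δ (m u) v * ι (does (u Fin.<? v))
      simplify u v with v ≟ m u
      ... | no v≢mu = trans (cong (λ b → ι (does ((u Fin.<? v) ×-dec (u ~? v))) * ι b) (dec-false (m u ≟ v) (v≢mu ∘ sym)))
                        (*-zeroʳ (ι (does ((u Fin.<? v) ×-dec (u ~? v)))))
      ... | yes refl with u Fin.<? m u
      ...   | no u≮mu rewrite dec-false (u Fin.<? m u) u≮mu = refl
      ...   | yes u<mu rewrite dec-true (u Fin.<? m u) u<mu | dec-true (u ~? m u) (proj₂ (edge u (Fin.<⇒≢ u<mu ∘ sym)))
                     | dec-true (m u ≟ m u) refl = refl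

    edgeCount≤β : ∀ {m} → IsMatching G full m → edgeCount G m ≤ β G
    edgeCount≤β {m} isM@(invol , _) = subst (_≤ β G) (trans (∣tabulate∣ (edgesOf m)) (#-edgesOf isM))
      (maxSize-upper matching? (Vec.tabulate (edgesOf m)) matching)
      where
      partner : ∀ {e} → e ∈ Vec.tabulate (edgesOf m) → m (src e) ≡ tgt e
      partner {e} e∈ with m (src e) ≟ tgt e | trans (sym (lookup∘tabulate (edgesOf m) e)) (∈⇒⟦⟧ e∈)
      ... | yes eq | _ = eq
      partner′ : ∀ {e} → e ∈ Vec.tabulate (edgesOf m) → m (tgt e) ≡ src e
      partner′ {e} e∈ = trans (cong m (sym (partner e∈))) (invol (src e))
      matching : Matching (Vec.tabulate (edgesOf m))
      matching e f e∈ f∈ e≢f =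
        (λ s≡s → e≢f (edge-unique e f s≡s (trans (sym (partner e∈)) (trans (cong m s≡s) (partner f∈))))) ,
        (λ s≡t → opposite s≡t (trans (sym (partner e∈)) (trans (cong m s≡t) (partner′ f∈)))) ,
        (λ t≡s → opposite (trans (sym (partner′ e∈)) (trans (cong m t≡s) (partner f∈))) t≡s) ,
        (λ t≡t → e≢f (edge-unique e f (trans (sym (partner′ e∈)) (trans (cong m t≡t) (partner′ f∈))) t≡t))
        where
        -- Both edges list their smaller end first, so neither is the reverse of the other.
        opposite : src e ≡ tgt f → tgt e ≡ src f → ⊥
        opposite s≡t t≡s = Fin.<-asym (proj₁ (edge-prop e)) (subst₂ Fin._<_ (sym t≡s) (sym s≡t) (proj₁ (edge-prop f)))

    module FromMatching (M : Subset (length edges)) (matching : Matching M) where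

      Incident : Edge → Vertex → Set
      Incident e u = u ≡ src e ⊎ u ≡ tgt e

      -- Makes `mate` independent of the incident edge that the search happens to return.
      incident-unique : ∀ {e f u} → e ∈ M → f ∈ M → Incident e u → Incident f u → e ≡ f
      incident-unique {e} {f} e∈ f∈ u-e u-f = decidable-stable (e ≟ f) (λ e≢f → apart (matching e f e∈ f∈ e≢f) u-e u-f)
        where
        apart : ∀ {u s t s′ t′ : Vertex} → s ≢ s′ × s ≢ t′ × t ≢ s′ × t ≢ t′ → (u ≡ s ⊎ u ≡ t) → (u ≡ s′ ⊎ u ≡ t′) → ⊥
        apart (ss , _ , _ , _) (inj₁ refl) (inj₁ eq) = ss eq
        apart (_ , st , _ , _) (inj₁ refl) (inj₂ eq) = st eq
        apart (_ , _ , ts , _) (inj₂ refl) (inj₁ eq) = ts eq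
        apart (_ , _ , _ , tt) (inj₂ refl) (inj₂ eq) = tt eq

      matchedEdge? : ∀ u → Dec (∃[ e ] e ∈ M × Incident e u)
      matchedEdge? u = any? (λ e → (e ∈? M) ×-dec ((u ≟ src e) ⊎-dec (u ≟ tgt e)))

      mate : Vertex → Vertex
      mate u with matchedEdge? u
      ... | yes (e , _ , inj₁ _) = tgt e
      ... | yes (e , _ , inj₂ _) = src e
      ... | no _                 = u

      src≢tgt : ∀ e → src e ≢ tgt e
      src≢tgt e = Fin.<⇒≢ (proj₁ (edge-prop e))

      mate-src : ∀ {e} → e ∈ M → mate (src e) ≡ tgt e
      mate-src {e} e∈ with matchedEdge? (src e)
      ... | no none = contradiction (e , e∈ , inj₁ refl) none
      ... | yes (f , f∈ , inc) with incident-unique e∈ f∈ (inj₁ refl) inc | inc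
      ...   | refl | inj₁ _  = refl
      ...   | refl | inj₂ eq = contradiction eq (src≢tgt e)

      mate-tgt : ∀ {e} → e ∈ M → mate (tgt e) ≡ src e
      mate-tgt {e} e∈ with matchedEdge? (tgt e)
      ... | no none = contradiction (e , e∈ , inj₂ refl) none
      ... | yes (f , f∈ , inc) with incident-unique e∈ f∈ (inj₂ refl) inc | inc
      ...   | refl | inj₁ eq = contradiction (sym eq) (src≢tgt e)
      ...   | refl | inj₂ _  = refl

      data MateView (u : Vertex) : Set where
        unmatched : mate u ≡ u → MateView u
        at-src    : ∀ e → e ∈ M → u ≡ src e → MateView u
        at-tgt    : ∀ e → e ∈ M → u ≡ tgt e → MateView u

      mateView : ∀ u → MateView u
      mateView u with matchedEdge? u in eq
      ... | yes (e , e∈ , inj₁ u≡) = at-src e e∈ u≡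
      ... | yes (e , e∈ , inj₂ u≡) = at-tgt e e∈ u≡
      ... | no _ = unmatched unmatched-mate
        where
        unmatched-mate : mate u ≡ u
        unmatched-mate rewrite eq = refl

      mate-isMatching : IsMatching G full mate
      mate-isMatching = invol , edge
        where
        invol : ∀ u → mate (mate u) ≡ u
        invol u with mateView u
        ... | unmatched eq     = trans (cong mate eq) eq
        ... | at-src e e∈ refl = trans (cong mate (mate-src e∈)) (mate-tgt e∈)
        ... | at-tgt e e∈ refl = trans (cong mate (mate-tgt e∈)) (mate-src e∈)
        edge : ∀ u → mate u ≢ u → true ≡ true × u ~ mate u
        edge u ne with mateView u
        ... | unmatched eq     = contradiction eq ne
        ... | at-src e e∈ refl = refl , subst (u ~_) (sym (mate-src e∈)) (proj₂ (edge-prop e))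
        ... | at-tgt e e∈ refl = refl , subst (u ~_) (sym (mate-tgt e∈)) (~-sym (proj₂ (edge-prop e)))

      -- Going from `M` to an involution and back gives `M` again, so no edges are lost in the
      -- count.
      edgesOf-mate : ∀ e → ⟦ M ⟧ e ≡ edgesOf mate e
      edgesOf-mate e with mate (src e) ≟ tgt e
      ... | no ne with ⟦ M ⟧ e in eq
      ...   | true  = contradiction (mate-src (⟦⟧⇒∈ M e eq)) ne
      ...   | false = refl
      edgesOf-mate e | yes eq with mateView (src e)
      ... | unmatched eq′ = contradiction (trans (sym eq′) eq) (src≢tgt e)
      ... | at-src f f∈ s≡s with edge-unique e f s≡s (trans (sym eq) (trans (cong mate s≡s) (mate-src f∈)))
      ...   | refl = ∈⇒⟦⟧ f∈
      edgesOf-mate e | yes eq | at-tgt f f∈ s≡t = contradiction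
        (subst₂ Fin._<_ (trans (sym (mate-tgt f∈)) (trans (cong mate (sym s≡t)) eq)) (sym s≡t) (proj₁ (edge-prop f)))
        (Fin.<-asym (proj₁ (edge-prop e)))

      ∣M∣≡edgeCount : ∣ M ∣ ≡ edgeCount G mate
      ∣M∣≡edgeCount = trans (∣∣≡# M) (trans (sum-cong (λ e → cong ι (edgesOf-mate e))) (#-edgesOf mate-isMatching))

    β-attained : ∃[ m ] IsMatching G full m × edgeCount G m ≡ β G
    β-attained with maxSize-attained matching? (Vec.tabulate (λ _ → false))
      (λ e _ e∈ _ _ → contradiction (lookup∘tabulate (λ _ → false) e) (true≢false (∈⇒⟦⟧ e∈)))
    ... | M , matching , size = mate , mate-isMatching , trans (sym ∣M∣≡edgeCount) size
      where open FromMatching M matching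

    surplus⇒bound : ∀ {k} → Surplus G k full → k + 4 * n G ≤ 7 * α G + 4 * β G
    surplus⇒bound {k} (I , m , (ind , _) , isM , bound) = begin
      k + 4 * n G                    ≡⟨ cong (λ s → k + 4 * s) (#-full (n G)) ⟨
      k + 4 * # full {n G}           ≤⟨ bound ⟩
      7 * # I + 2 * cov G m          ≡⟨ cong (7 * # I +_) (trans (cong (2 *_) (cov-even G isM)) (sym (*-assoc 2 2 (edgeCount G m)))) ⟩
      7 * # I + 4 * edgeCount G m    ≤⟨ +-mono-≤ (*-monoʳ-≤ 7 (indep≤α I ind)) (*-monoʳ-≤ 4 (edgeCount≤β isM)) ⟩
      7 * α G + 4 * β G              ∎
      where open ≤-Reasoning

    2β≤n : 2 * β G ≤ n G
    2β≤n = let m , isM , size = β-attained in begin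
      2 * β G             ≡⟨ cong (2 *_) size ⟨
      2 * edgeCount G m   ≡⟨ cov-even G isM ⟨
      cov G m             ≤⟨ cov≤#S G isM ⟩
      # full {n G}        ≡⟨ #-full (n G) ⟩
      n G                 ∎
      where open ≤-Reasoning

  -- The equality case

  module _ (G : Graph) where
    open Graph G using (Vertex; _~_; ~-sym)

    restrict : VSet (n G) → (Vertex → Vertex) → Vertex → Vertex
    restrict C m v = if C v then m v else v

    restrict-isMatching : ∀ {S T m} (D : VSet (n G)) → IsMatching G S m →
      (∀ v → D v ≡ true → S v ≡ true → T v ≡ true) → (∀ v → D v ≡ true → D (m v) ≡ true) →
      IsMatching G T (restrict D m)
    restrict-isMatching {S} {T} {m} D (invol , edge) D∩S⊆T D-stable = invol′ , edge′
      where
      invol′ : ∀ v → restrict D m (restrict D m v) ≡ v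
      invol′ v with D v in v∈D
      ... | true  rewrite D-stable v v∈D = invol v
      ... | false rewrite v∈D = refl
      edge′ : ∀ v → restrict D m v ≢ v → T v ≡ true × v ~ restrict D m v
      edge′ v ne with D v in v∈D
      ... | true  = D∩S⊆T v v∈D (proj₁ (edge v ne)) , proj₂ (edge v ne)
      ... | false = contradiction refl ne

    cov-restrict : ∀ C m → cov G m ≡ cov G (restrict C m) + cov G (restrict (not ∘ C) m)
    cov-restrict C m = trans (sum-cong lemma) (sum-+ _ _)
      where
      lemma : ∀ v → ι (not (does (m v ≟ v))) ≡
        ι (not (does (restrict C m v ≟ v))) + ι (not (does (restrict (not ∘ C) m v ≟ v)))
      lemma v with C v
      ... | true  rewrite dec-true (v ≟ v) refl = sym (+-identityʳ _)
      ... | false rewrite dec-true (v ≟ v) refl = refl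

    star-closed : ∀ {C} → Closed G full C → ∀ {u w} → C u ≡ true → Star _~_ u w → C w ≡ true
    star-closed closed u∈C ε = u∈C
    star-closed closed u∈C (u~x ◅ path) = star-closed closed (closed _ _ u∈C refl u~x) path

    module _ (C : Subset (n G)) where

      private
        H = G [[ C ]]

        vs : List Vertex
        vs = filter (_∈? C) (allFin (n G))

      -- The bridge between `H` and `G`: order, degrees and set sizes in `H` all become indicator
      -- sums over the vertices of `G`.
      sum-induced : ∀ f → sum {n H} (λ i → f (List.lookup vs i)) ≡ sum (λ v → ι (⟦ C ⟧ v) * f v)
      sum-induced f = trans (sym (listSum≡sum vs f)) (trans (listSum-filter (_∈? C) (allFin (n G)) f)
        (trans (listSum-tabulate (λ i → i) _) (sum-cong (λ v → cong (λ b → ι b * f v) (does-∈? C v)))))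

      n-induced : n H ≡ # ⟦ C ⟧
      n-induced = trans (sym (#-full (n H))) (trans (sum-induced (λ _ → 1)) (sum-cong (λ v → *-identityʳ _)))

      lookup-∈ : ∀ i → ⟦ C ⟧ (List.lookup vs i) ≡ true
      lookup-∈ i = ∈⇒⟦⟧ (proj₂ (List.∈-filter⁻ (_∈? C) {xs = allFin (n G)} (List.∈-lookup {xs = vs} i)))

      triangleFree-induced : TriangleFree G → TriangleFree H
      triangleFree-induced tf u v w = tf (List.lookup vs u) (List.lookup vs v) (List.lookup vs w)

      maxDeg-induced : MaxDeg≤4 G → MaxDeg≤4 H
      maxDeg-induced Δ≤4 i = ≤-trans (≤-reflexive (sum-induced (adj G (List.lookup vs i))))
        (≤-trans (deg≤sum G ⟦ C ⟧ (List.lookup vs i)) (Δ≤4 (List.lookup vs i)))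

      indep≤α-induced : ∀ I → Indep G I → I ⊆ᵇ ⟦ C ⟧ → # I ≤ α H
      indep≤α-induced I ind I⊆C = subst (_≤ α H) size
        (indep≤α H (I ∘ List.lookup vs) (λ i j → ind (List.lookup vs i) (List.lookup vs j)))
        where
        lemma : ∀ v → ι (⟦ C ⟧ v) * ι (I v) ≡ ι (I v)
        lemma v with I v in v∈I
        ... | true  rewrite I⊆C v v∈I = refl
        ... | false = *-zeroʳ (ι (⟦ C ⟧ v))
        size : # (I ∘ List.lookup vs) ≡ # I
        size = trans (sum-induced (ι ∘ I)) (sum-cong lemma)

      -- An independent set of `H` is replaced by its image in `G`, which is independent, lies in
      -- `C` and is at least as large.
      α-induced≤ : ∀ {k} → (∀ I → Indep G I → I ⊆ᵇ ⟦ C ⟧ → # I ≤ k) → α H ≤ k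
      α-induced≤ {k} bound = let J , ind , size = α-attained H in subst (_≤ k) size (pushforward J ind)
        where
        pushforward : ∀ J → Indep H J → # J ≤ k
        pushforward J ind = ≤-trans (sum-mono (λ i → ⊆⇒ι≤ (J⊆I i)))
          (≤-trans (≤-reflexive (sum-induced (ι ∘ I))) (≤-trans (sum-mono lemma) (bound I I-ind I⊆C)))
          where
          I? : ∀ v → Dec (∃[ i ] List.lookup vs i ≡ v × J i ≡ true)
          I? v = any? (λ i → (List.lookup vs i ≟ v) ×-dec (J i Bool.≟ true))
          I : VSet (n G)
          I v = does (I? v)
          I⁻ : ∀ v → I v ≡ true → ∃[ i ] List.lookup vs i ≡ v × J i ≡ true
          I⁻ v v∈I with I? v
          ... | yes p = p
          J⊆I : ∀ i → J i ≡ true → I (List.lookup vs i) ≡ true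
          J⊆I i i∈J = dec-true (I? (List.lookup vs i)) (i , refl , i∈J)
          I-ind : Indep G I
          I-ind u v u∈I v∈I u~v with I⁻ u u∈I | I⁻ v v∈I
          ... | i , refl , i∈J | j , refl , j∈J = ind i j i∈J j∈J u~v
          I⊆C : I ⊆ᵇ ⟦ C ⟧
          I⊆C v v∈I with I⁻ v v∈I
          ... | i , refl , _ = lookup-∈ i
          lemma : ∀ v → ι (⟦ C ⟧ v) * ι (I v) ≤ ι (I v)
          lemma v with ⟦ C ⟧ v
          ... | true  = ≤-reflexive (*-identityˡ _)
          ... | false = z≤n

    isComponent⇒closed : ∀ {C} → IsComponent G C → Closed G full ⟦ C ⟧
    isComponent⇒closed {C} (r , reach) u w u∈C _ u~w =
      ∈⇒⟦⟧ (Equivalence.from (reach w) (Equivalence.to (reach u) (⟦⟧⇒∈ C u u∈C) ◅◅ (u~w ◅ ε)))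

    isComponent⇒connected : ∀ {C} → IsComponent G C → ∃[ r ] Connected G ⟦ C ⟧ r
    isComponent⇒connected {C} comp@(r , reach) = r , r∈C ,
      λ u u∈C → inside-C r∈C (Equivalence.to (reach u) (⟦⟧⇒∈ C u u∈C))
      where
      r∈C : ⟦ C ⟧ r ≡ true
      r∈C = ∈⇒⟦⟧ (Equivalence.from (reach r) ε)
      inside-C : ∀ {x u} → ⟦ C ⟧ x ≡ true → Star _~_ x u → Star (λ x y → x ~ y × ⟦ C ⟧ y ≡ true) x u
      inside-C x∈C ε = ε
      inside-C x∈C (x~y ◅ path) = (x~y , y∈C) ◅ inside-C y∈C path
        where y∈C = isComponent⇒closed comp _ _ x∈C refl x~y

    connected⇒isComponent : ∀ {C r} → Connected G C r → Closed G full C → IsComponent G (Vec.tabulate C)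
    connected⇒isComponent {C} {r} (r∈C , path) closed = r , λ u → mk⇔
      (λ u∈ → Star.map proj₁ (path u (trans (sym (lookup∘tabulate C u)) (∈⇒⟦⟧ u∈))))
      (λ walk → ⟦⟧⇒∈ (Vec.tabulate C) u (trans (lookup∘tabulate C u) (star-closed closed r∈C walk)))

    module Upper (sizes : ∀ C → IsComponent G C → n (G [[ C ]]) ≡ 13 × α (G [[ C ]]) ≡ 4) where

      -- Components are split off one by one. Each adds at most 7 · 4 + 2 · 12 = 4 · 13, since a
      -- matching covers an even number of its 13 vertices.
      upper : ∀ k S → # S ≤ k → Closed G full S →
        ∀ I m → Indep G I → I ⊆ᵇ S → IsMatching G S m → 7 * # I + 2 * cov G m ≤ 4 * # S
      upper zero S #S≤0 _ I m _ I⊆S isM =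
        ≤-trans (+-mono-≤ (*-monoʳ-≤ 7 (≤-trans (#-mono I⊆S) #S≤0)) (*-monoʳ-≤ 2 (≤-trans (cov≤#S G isM) #S≤0))) z≤n
      upper (suc k) S #S≤ S-closed I m ind I⊆S isM@(_ , edge) with any? (λ v → S v Bool.≟ true)
      ... | no empty = ≤-trans (+-mono-≤ (*-monoʳ-≤ 7 (≤-trans (#-mono I⊆S) #S≤0)) (*-monoʳ-≤ 2 (≤-trans (cov≤#S G isM) #S≤0))) z≤n
        where
        #S≤0 : # S ≤ 0
        #S≤0 = ≮⇒≥ λ #S>0 → empty (#>0⇒member S #S>0)
      ... | yes (r , r∈S) with component G S r r∈S
      ...   | C , C⊆S , conn , closed = begin
        7 * # I + 2 * cov G m
          ≡⟨ cong₂ (λ i c → 7 * i + 2 * c) #I≡ (cov-restrict C m) ⟩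
        7 * (# I₁ + # I₂) + 2 * (cov G m₁ + cov G m₂)
          ≡⟨ rearrange (# I₁) (# I₂) (cov G m₁) (cov G m₂) ⟩
        (7 * # I₁ + 2 * cov G m₁) + (7 * # I₂ + 2 * cov G m₂)
          ≤⟨ +-mono-≤ (+-mono-≤ (*-monoʳ-≤ 7 I₁≤4) (*-monoʳ-≤ 2 m₁≤12)) rest ⟩
        4 * 13 + 4 * # (S ∖ C)
          ≡⟨ *-distribˡ-+ 4 13 (# (S ∖ C)) ⟨
        4 * (13 + # (S ∖ C))
          ≡⟨ cong (λ c → 4 * (c + # (S ∖ C))) #C≡13 ⟨
        4 * (# C + # (S ∖ C))
          ≡⟨ cong (4 *_) (#-∖ S C C⊆S) ⟨
        4 * # S ∎
        where
        open ≤-Reasoning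
        rearrange : ∀ x y z t → 7 * (x + y) + 2 * (z + t) ≡ (7 * x + 2 * z) + (7 * y + 2 * t)
        rearrange = solve-∀
        C-closed : Closed G full C
        C-closed u w u∈C w∈ u~w = closed u w u∈C (S-closed u w (C⊆S u u∈C) w∈ u~w) u~w
        comp = connected⇒isComponent conn C-closed
        #C≡13 : # C ≡ 13
        #C≡13 = trans (sum-cong (λ v → cong ι (sym (lookup∘tabulate C v))))
          (trans (sym (n-induced (Vec.tabulate C))) (proj₁ (sizes _ comp)))
        I₁ I₂ : VSet (n G)
        I₁ v = I v ∧ C v
        I₂ = I ∖ C
        I₁⁻ : ∀ v → I₁ v ≡ true → I v ≡ true × C v ≡ true
        I₁⁻ v v∈ with I v | C v
        ... | true | true = refl , refl
        #I≡ : # I ≡ # I₁ + # I₂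
        #I≡ = trans (sum-cong lemma) (sum-+ _ _)
          where
          lemma : ∀ v → ι (I v) ≡ ι (I₁ v) + ι (I₂ v)
          lemma v with I v | C v
          ... | true  | true  = refl
          ... | true  | false = refl
          ... | false | _     = refl
        m₁ = restrict C m
        m₂ = restrict (not ∘ C) m
        C-stable : ∀ v → C v ≡ true → C (m v) ≡ true
        C-stable v v∈C with m v ≟ v
        ... | yes eq = trans (cong C eq) v∈C
        ... | no ne  = C-closed v (m v) v∈C refl (proj₂ (edge v ne))
        ∁C-stable : ∀ v → not (C v) ≡ true → not (C (m v)) ≡ true
        ∁C-stable v v∉C with C (m v) in mv∈C
        ... | false = refl
        ... | true  = contradiction
          (trans (sym (cong (not ∘ C) (proj₁ isM v))) (cong not (C-stable (m v) mv∈C)))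
          (true≢false v∉C)
        I₁≤4 : # I₁ ≤ 4
        I₁≤4 = ≤-trans (indep≤α-induced (Vec.tabulate C) I₁
          (λ u v u∈ v∈ → ind u v (proj₁ (I₁⁻ u u∈)) (proj₁ (I₁⁻ v v∈)))
          (λ v v∈ → trans (lookup∘tabulate C v) (proj₂ (I₁⁻ v v∈))))
          (≤-reflexive (proj₂ (sizes _ comp)))
        m₁-isMatching : IsMatching G C m₁
        m₁-isMatching = restrict-isMatching C isM (λ v v∈C _ → v∈C) C-stable
        m₁≤12 : cov G m₁ ≤ 12
        m₁≤12 = even≤13⇒≤12 (edgeCount G m₁) (cov-even G m₁-isMatching)
          (≤-trans (cov≤#S G m₁-isMatching) (≤-reflexive #C≡13))
          where
          even≤13⇒≤12 : ∀ {x} h → x ≡ 2 * h → x ≤ 13 → x ≤ 12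
          even≤13⇒≤12 h refl 2h≤13 = *-monoʳ-≤ 2 (s≤s⁻¹ (*-cancelˡ-< 2 h 7 (s≤s 2h≤13)))
        rest : 7 * # I₂ + 2 * cov G m₂ ≤ 4 * # (S ∖ C)
        rest = upper k (S ∖ C) (#-∖-≤ S C r C⊆S (proj₁ conn) #S≤) R-closed I₂ m₂
          (λ u v u∈ v∈ → ind u v (∖-⊆ I C u u∈) (∖-⊆ I C v v∈))
          (λ v v∈ → ∖⁺ S C v (I⊆S v (∖-⊆ I C v v∈)) (proj₂ (∖⁻ I C v v∈)))
          (restrict-isMatching (not ∘ C) isM
            (λ v v∉C v∈S → ∖⁺ S C v v∈S (Bool.not-injective v∉C)) ∁C-stable)
          where
          R-closed : Closed G full (S ∖ C)
          R-closed u w u∈R _ u~w with ∖⁻ S C u u∈R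
          ... | u∈S , u∉C = ∖⁺ S C w (S-closed u w u∈S refl u~w) w∉C
            where
            w∉C : C w ≡ false
            w∉C with C w in w∈C
            ... | false = refl
            ... | true  = contradiction u∉C (true≢false (C-closed w u w∈C refl (~-sym u~w)))

      7α+4β≤4n : 7 * α G + 4 * β G ≤ 4 * n G
      7α+4β≤4n = let I , ind , #I≡α = α-attained G; m , isM , size = β-attained G in begin
        7 * α G + 4 * β G              ≡⟨ cong₂ (λ i c → 7 * i + 4 * c) #I≡α size ⟨
        7 * # I + 4 * edgeCount G m    ≡⟨ cong (7 * # I +_) (*-assoc 2 2 (edgeCount G m)) ⟩
        7 * # I + 2 * (2 * edgeCount G m) ≡⟨ cong (λ c → 7 * # I + 2 * c) (cov-even G isM) ⟨
        7 * # I + 2 * cov G m          ≤⟨ upper (n G) full (≤-reflexive (#-full (n G))) (λ _ _ _ _ _ → refl) I m ind (λ _ _ → refl) isM ⟩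
        4 * # full {n G}               ≡⟨ cong (4 *_) (#-full (n G)) ⟩
        4 * n G                        ∎
        where open ≤-Reasoning

    module _ (tf : TriangleFree G) (Δ≤4 : MaxDeg≤4 G) where

      4n≤7α+4β : 4 * n G ≤ 7 * α G + 4 * β G
      4n≤7α+4β = surplus⇒bound G {0} (surplus G tf Δ≤4 full)

      -- A strict component, together with surplus 0 on the rest, would make the inequality strict
      -- for `G`.
      extremal⇒tight : 7 * α G + 4 * β G ≡ 4 * n G → ∀ C → IsComponent G C → Tight G ⟦ C ⟧
      extremal⇒tight extremal C comp = conclude (dichotomy G tf Δ≤4 ⟦ C ⟧ _ (proj₂ (isComponent⇒connected comp)))
        where
        conclude : Dichotomy G tf Δ≤4 ⟦ C ⟧ → Tight G ⟦ C ⟧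
        conclude (inj₂ (tight , _)) = tight
        conclude (inj₁ strict) = contradiction extremal (>⇒≢ (surplus⇒bound G {1}
          (surplus-split G (λ _ _ → refl) (isComponent⇒closed comp) 1 0 strict (surplus G tf Δ≤4 (full ∖ ⟦ C ⟧)))))

  -- Numbers of the equality case, and passage to the rationals

  tight-order : ∀ {n a b} → n ≡ 13 → a ≤ 4 → 2 * b ≤ n → 4 * n ≤ 7 * a + 4 * b → n ≡ 13 × a ≡ 4 × b ≡ 6
  tight-order {a = a} {b} refl a≤4 2b≤13 bound = refl , table {a} (s≤s a≤4) {b} (*-cancelˡ-< 2 b 7 (s≤s 2b≤13)) bound
    where
    -- 52 = 4 · 13 = 7 · 4 + 4 · 6, so both caps must be attained.
    table : ∀ {a} → a < 5 → ∀ {b} → b < 7 → 52 ≤ 7 * a + 4 * b → a ≡ 4 × b ≡ 6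
    table = from-yes (allUpTo? (λ a → allUpTo? (λ b →
      (52 ≤? 7 * a + 4 * b) →-dec ((a ℕ.≟ 4) ×-dec (b ℕ.≟ 6))) 7) 5)

  -- Unnormalised fractions avoid the gcd and compare by cross-multiplication. `mkℚᵘ` takes the
  -- denominator minus one, so 3 stands for quarters.
  toℚᵘ-weighted : ∀ a b → ℚ.toℚᵘ ((ℤ.+ 7 ℚ./ 4) ℚ.* ℕ→ℚ a ℚ.+ ℕ→ℚ b) ℚᵘ.≃ ℚᵘ.mkℚᵘ (ℤ.+ (7 * a + 4 * b)) 3
  toℚᵘ-weighted a b = ℚᵘ.≃-trans (ℚ.toℚᵘ-homo-+ ((ℤ.+ 7 ℚ./ 4) ℚ.* ℕ→ℚ a) (ℕ→ℚ b))
    (ℚᵘ.≃-trans (ℚᵘ.+-cong (ℚᵘ.≃-trans (ℚ.toℚᵘ-homo-* (ℤ.+ 7 ℚ./ 4) (ℕ→ℚ a))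
        (ℚᵘ.*-cong (ℚ.toℚᵘ-fromℚᵘ (ℚᵘ.mkℚᵘ (ℤ.+ 7) 3)) (ℚ.toℚᵘ-fromℚᵘ (ℚᵘ.mkℚᵘ (ℤ.+ a) 0))))
        (ℚ.toℚᵘ-fromℚᵘ (ℚᵘ.mkℚᵘ (ℤ.+ b) 0)))
      (ℚᵘ.*≡* (cong (ℤ._* ℤ.+ 4) numerator)))
    where
    numerator : ℤ.+ 7 ℤ.* ℤ.+ a ℤ.* ℤ.+ 1 ℤ.+ ℤ.+ b ℤ.* ℤ.+ 4 ≡ ℤ.+ (7 * a + 4 * b)
    numerator = trans (cong₂ ℤ._+_ (trans (ℤ.*-identityʳ (ℤ.+ 7 ℤ.* ℤ.+ a)) (sym (ℤ.pos-* 7 a)))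
      (trans (sym (ℤ.pos-* b 4)) (cong ℤ.+_ (*-comm b 4)))) (sym (ℤ.pos-+ (7 * a) (4 * b)))

  toℚᵘ-ℕ→ℚ : ∀ k → ℚ.toℚᵘ (ℕ→ℚ k) ℚᵘ.≃ ℚᵘ.mkℚᵘ (ℤ.+ k) 0
  toℚᵘ-ℕ→ℚ k = ℚ.toℚᵘ-fromℚᵘ (ℚᵘ.mkℚᵘ (ℤ.+ k) 0)

  weighted-≥ : ∀ {k a b} → 4 * k ≤ 7 * a + 4 * b → (ℤ.+ 7 ℚ./ 4) ℚ.* ℕ→ℚ a ℚ.+ ℕ→ℚ b ℚ.≥ ℕ→ℚ k
  weighted-≥ {k} {a} {b} bound = ℚ.toℚᵘ-cancel-≤ (ℚᵘ.≤-respˡ-≃ (ℚᵘ.≃-sym (toℚᵘ-ℕ→ℚ k))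
    (ℚᵘ.≤-respʳ-≃ (ℚᵘ.≃-sym (toℚᵘ-weighted a b)) (ℚᵘ.*≤* (subst₂ ℤ._≤_ (trans (cong ℤ.+_ (*-comm 4 k)) (ℤ.pos-* k 4))
      (sym (ℤ.*-identityʳ _)) (ℤ.+≤+ bound)))))

  weighted-≡⁺ : ∀ {k a b} → 7 * a + 4 * b ≡ 4 * k → (ℤ.+ 7 ℚ./ 4) ℚ.* ℕ→ℚ a ℚ.+ ℕ→ℚ b ≡ ℕ→ℚ k
  weighted-≡⁺ {k} {a} {b} eq = ℚ.toℚᵘ-injective (ℚᵘ.≃-trans (toℚᵘ-weighted a b) (ℚᵘ.≃-trans
    (ℚᵘ.*≡* (trans (ℤ.*-identityʳ _) (trans (cong ℤ.+_ (trans eq (*-comm 4 k))) (ℤ.pos-* k 4))))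
    (ℚᵘ.≃-sym (toℚᵘ-ℕ→ℚ k))))

  weighted-≡⁻ : ∀ {k a b} → (ℤ.+ 7 ℚ./ 4) ℚ.* ℕ→ℚ a ℚ.+ ℕ→ℚ b ≡ ℕ→ℚ k → 7 * a + 4 * b ≡ 4 * k
  weighted-≡⁻ {k} {a} {b} eq = numerators (ℚᵘ.≃-trans (ℚᵘ.≃-sym (toℚᵘ-weighted a b))
    (ℚᵘ.≃-trans (ℚᵘ.≃-reflexive (cong ℚ.toℚᵘ eq)) (toℚᵘ-ℕ→ℚ k)))
    where
    numerators : ℚᵘ.mkℚᵘ (ℤ.+ (7 * a + 4 * b)) 3 ℚᵘ.≃ ℚᵘ.mkℚᵘ (ℤ.+ k) 0 → 7 * a + 4 * b ≡ 4 * k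
    numerators (ℚᵘ.*≡* eq) = ℤ.+-injective (trans (sym (ℤ.*-identityʳ _))
      (trans eq (trans (sym (ℤ.pos-* k 4)) (cong ℤ.+_ (*-comm k 4)))))

open Development
open import Defs
open import Data.Integer.Base using (+_)
open import Data.Nat.Base using (_≤_)
open import Data.Nat.Properties using (≤-antisym)
open import Data.Product.Base using (_×_; _,_; proj₁; proj₂)
open import Data.Rational.Base using (_/_; _+_; _*_; _≥_)
open import Function.Bundles using (_⇔_; mk⇔)
open import Relation.Binary.PropositionalEquality using (_≡_; trans)

theorem1 : (G : Graph) → TriangleFree G → Δ G ≤ 4 →
    ((+ 7 / 4) * ℕ→ℚ (α G) + ℕ→ℚ (β G) ≥ ℕ→ℚ (n G))
    × ((+ 7 / 4) * ℕ→ℚ (α G) + ℕ→ℚ (β G) ≡ ℕ→ℚ (n G)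
    ⇔ (∀ C → IsComponent G C →
    n (G [[ C ]]) ≡ 13 × α (G [[ C ]]) ≡ 4 × β (G [[ C ]]) ≡ 6))
theorem1 G tf Δ≤4 = weighted-≥ {n G} {α G} {β G} (4n≤7α+4β G tf maxDeg) , mk⇔ forward backward
  where
  maxDeg : MaxDeg≤4 G
  maxDeg = Δ≤⇒MaxDeg≤4 G Δ≤4
  forward : (+ 7 / 4) * ℕ→ℚ (α G) + ℕ→ℚ (β G) ≡ ℕ→ℚ (n G) →
    ∀ C → IsComponent G C → n (G [[ C ]]) ≡ 13 × α (G [[ C ]]) ≡ 4 × β (G [[ C ]]) ≡ 6
  -- Tightness gives n = 13 and α ≤ 4; the inequality for the component itself then forces α = 4 and
  -- β = 6.
  forward eq C comp = tight-order {n H} {α H} {β H} (trans (n-induced G C) (proj₁ tight))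
    (α-induced≤ G C (proj₂ tight)) (2β≤n H)
    (4n≤7α+4β H (triangleFree-induced G C tf) (maxDeg-induced G C maxDeg))
    where
    H = G [[ C ]]
    tight = extremal⇒tight G tf maxDeg (weighted-≡⁻ {n G} {α G} {β G} eq) C comp
  backward : (∀ C → IsComponent G C → n (G [[ C ]]) ≡ 13 × α (G [[ C ]]) ≡ 4 × β (G [[ C ]]) ≡ 6) →
    (+ 7 / 4) * ℕ→ℚ (α G) + ℕ→ℚ (β G) ≡ ℕ→ℚ (n G)
  backward sizes = weighted-≡⁺ {n G} {α G} {β G} (≤-antisym
    (Upper.7α+4β≤4n G (λ C comp → proj₁ (sizes C comp) , proj₁ (proj₂ (sizes C comp))))
    (4n≤7α+4β G tf maxDeg))
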